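{- Let $\mathrm{op}$ be any one of the following operations on permutations: block reversal, block transposition, block interchange, prefix transposition, prefix reversal, cut-paste. For every positive integer $k$, the set of all permutations (of all lengths) that can be transformed into the identity permutation of the same length by at most $k$ applications of $\mathrm{op}$ is a polynomial class.
   Context: A block of $\pi=\pi_1\cdots\pi_n$ is a contiguous string $\pi_i\pi_{i+1}\cdots\pi_{i+m}$; a prefix is a block starting at $\pi_1$. Block reversal: reverse the entries of a block. Block transposition: move a block to another location in the sequence. Block interchange: swap the positions of two non-intersecting blocks. Prefix transposition: move a prefix to another location. Prefix reversal: reverse a prefix. Cut-paste: move a block to another location, optionally reversing it. A permutation class is a set of permutations closed under taking patterns ($\sigma$ is a pattern of $\pi$ if some subsequence of $\pi$ has the same relative order as $\sigma$). A permutation class $\mathcal{C}$ is a polynomial class if the number of permutations of length $n$ in $\mathcal{C}$ is given by a polynomial in $n$ for all sufficiently large $n$. -}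

module Defs where

open import Data.Nat using (ℕ; zero; suc; _<_; _≤_)
open import Data.Integer using (+_)
open import Data.Rational using (ℚ; _/_; 0ℚ) renaming (_+_ to _+ℚ_; _*_ to _*ℚ_)
open import Data.List using (List; []; _∷_; _++_; reverse; length; upTo)
open import Data.List.Relation.Binary.Permutation.Propositional using (_↭_)
open import Data.List.Relation.Binary.Pointwise using (Pointwise)
open import Data.List.Relation.Binary.Sublist.Propositional using (_⊆_)
open import Data.List.Relation.Unary.Unique.Propositional using (Unique)
open import Data.List.Membership.Propositional using (_∈_)
open import Data.Product using (_×_; Σ; ∃)
open import Function.Bundles using (_⇔_)
open import Relation.Binary.PropositionalEquality using (_≡_)

Perm : List ℕ → Set
Perm π = π ↭ upTo (length π)

idPerm : ℕ → List ℕ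
idPerm n = upTo n

data OrdIso : List ℕ → List ℕ → Set where
  []  : OrdIso [] []
  _∷_ : ∀ {x y xs ys} →
        Pointwise (λ a b → ((x < a) ⇔ (y < b)) × ((a < x) ⇔ (b < y))) xs ys →
        OrdIso xs ys → OrdIso (x ∷ xs) (y ∷ ys)

_≼_ : List ℕ → List ℕ → Set
σ ≼ π = Σ (List ℕ) (λ τ → (τ ⊆ π) × OrdIso σ τ)

data Op : Set where
  blockReversal blockTransposition blockInterchange
    prefixTransposition prefixReversal cutPaste : Op

data Step : Op → List ℕ → List ℕ → Set where
  brev  : ∀ a b c → Step blockReversal (a ++ b ++ c) (a ++ reverse b ++ c)
  btr   : ∀ a b c d → Step blockTransposition (a ++ b ++ c ++ d) (a ++ c ++ b ++ d)
  bint  : ∀ a b c d e → Step blockInterchange (a ++ b ++ c ++ d ++ e) (a ++ d ++ c ++ b ++ e)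
  ptr   : ∀ b c d → Step prefixTransposition (b ++ c ++ d) (c ++ b ++ d)
  prev  : ∀ b c → Step prefixReversal (b ++ c) (reverse b ++ c)
  cpR   : ∀ a b c d → Step cutPaste (a ++ b ++ c ++ d) (a ++ c ++ b ++ d)
  cpRr  : ∀ a b c d → Step cutPaste (a ++ b ++ c ++ d) (a ++ c ++ reverse b ++ d)
  cpL   : ∀ a b c d → Step cutPaste (a ++ c ++ b ++ d) (a ++ b ++ c ++ d)
  cpLr  : ∀ a b c d → Step cutPaste (a ++ c ++ b ++ d) (a ++ reverse b ++ c ++ d)

data Within (op : Op) : ℕ → List ℕ → List ℕ → Set where
  done : ∀ {k π} → Within op k π π
  step : ∀ {k π ρ σ} → Step op π ρ → Within op k ρ σ → Within op (suc k) π σ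

Sortable : Op → ℕ → List ℕ → Set
Sortable op k π = Perm π × Within op k π (idPerm (length π))

IsPermClass : (List ℕ → Set) → Set
IsPermClass C = (∀ π → C π → Perm π) × (∀ π σ → C π → Perm σ → σ ≼ π → C σ)

evalPoly : List ℚ → ℕ → ℚ
evalPoly [] n = 0ℚ
evalPoly (c ∷ cs) n = c +ℚ ((+ n / 1) *ℚ evalPoly cs n)

HasCount : (List ℕ → Set) → ℕ → ℕ → Set
HasCount C n m = Σ (List (List ℕ)) (λ L →
  Unique L × (∀ σ → (σ ∈ L) ⇔ (C σ × length σ ≡ n)) × length L ≡ m)

IsPolynomialClass : (List ℕ → Set) → Set
IsPolynomialClass C = IsPermClass C ×
  Σ (List ℚ) (λ p → Σ ℕ (λ N → ∀ n → N ≤ n →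
     Σ ℕ (λ m → HasCount C n m × (+ m / 1) ≡ evalPoly p n)))

{-# OPTIONS --safe #-}
module Submission where

-- Cut a permutation into its maximal monotone runs of consecutive values. It is
-- recorded by a code: for every run its rank by value, its direction and its length.
-- One operation cuts at most four adjacencies, so a permutation sortable in k steps
-- has at most 4k + 1 runs, and a run of more than 4k + 1 values contains a neighbouring
-- pair that is never cut. The value there can be duplicated throughout the sorting
-- sequence, which lengthens that run by one; deleting a value shortens a run. Hence
-- sortability is unaffected by the exact lengths of the long runs, and codes of total
-- length n in a set with this stability property are counted by iterated cumulative
-- sums, that is, by an eventually polynomial function.

open import Defs
open import Data.Bool using (Bool; true; false; not; if_then_else_)
import Data.Bool as Bool
import Data.Integer as ℤ
import Data.Integer.Properties as ℤ
open import Data.List using (List; []; _∷_; [_]; map; _++_; length; reverse; concatMap; upTo; applyUpTo; foldr; filter; cartesianProduct; cartesianProductWith)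
open import Data.List.Membership.Propositional using (_∈_)
open import Data.List.Membership.Propositional.Properties
open import Data.List.Properties
open import Data.List.Relation.Binary.Permutation.Propositional using (_↭_; ↭-refl; ↭-trans; ↭-sym; prep; swap; ↭⇒↭ₛ)
import Data.List.Relation.Binary.Permutation.Propositional.Properties as Perm
import Data.List.Relation.Binary.Permutation.Setoid.Properties as PermSetoid
open import Data.List.Relation.Binary.Pointwise as Pointwise using (Pointwise; []; _∷_)
open import Data.List.Relation.Binary.Sublist.Propositional using (_⊆_; []; _∷ʳ_; _∷_)
open import Data.List.Relation.Binary.Sublist.Propositional.Properties using (All-resp-⊆)
open import Data.List.Relation.Unary.All as All using (All; []; _∷_)
import Data.List.Relation.Unary.All.Properties as All
open import Data.List.Relation.Unary.AllPairs using ([]; _∷_)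
open import Data.List.Relation.Unary.Any using (here; there)
open import Data.List.Relation.Unary.Linked as Linked using (Linked; []; [-]; _∷_)
import Data.List.Relation.Unary.Linked.Properties as Linked
open import Data.List.Relation.Unary.Unique.Propositional using (Unique)
import Data.List.Relation.Unary.Unique.Propositional.Properties as Unique
open import Data.Nat using (ℕ; zero; suc; _+_; _*_; _∸_; _≤_; _<_; z≤n; s≤s; z<s; s<s; _≟_)
open import Data.Nat.Properties
open import Data.Nat.Solver using (module +-*-Solver)
open import Data.Product using (_×_; _,_; ∃; ∃₂; ∃-syntax; proj₁; proj₂; map₂)
open import Data.Rational using (ℚ; _/_; 0ℚ; 1ℚ; toℚᵘ) renaming (_+_ to _+ℚ_; _*_ to _*ℚ_; -_ to -ℚ_; _-_ to _-ℚ_)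
import Data.Rational.Properties as ℚ
import Data.Rational.Solver as ℚSolver
import Data.Rational.Unnormalised as ℚᵘ
import Data.Rational.Unnormalised.Properties as ℚᵘ
open import Data.Sum using (_⊎_; inj₁; inj₂)
open import Function using (_∘_)
open import Function.Bundles using (_⇔_; mk⇔; Equivalence)
open import Function.Construct.Identity using (⇔-id)
open import Function.Construct.Symmetry using (⇔-sym)
open import Relation.Binary.PropositionalEquality hiding ([_])
open import Relation.Nullary using (¬_; Dec; yes; no; contradiction; does)
open import Relation.Nullary.Decidable using (_×-dec_; _⊎-dec_; _→-dec_; ¬?; map′; dec-true; dec-false)
open import Relation.Unary using (Decidable)

open Equivalence using (to; from)

-- Eventually polynomial functions

-- The obstacle to duplicating a value is reversal: a block containing both copies comes out with
-- the copies exchanged. The copies finish in increasing order only if their initial order matches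
-- the parity of the reversals ahead, and they prolong a run only if they are read in its direction.
-- Values therefore carry signs, determined backwards from the all-positive identity, and
-- adjacencies are judged with signs: a pair that is intact in this sense has the direction of its
-- run as its sign. The constant 4 comes from block interchange, which rearranges five blocks with
-- four joints. Deletion is the same blow-up with weight 0, where signs do not matter; it yields
-- closure under patterns as well as the shortening of runs. Runs are coded by rank rather than by
-- value, so that duplicating a value changes a single multiplicity and the letters come from a
-- finite alphabet. Counting codes instead of permutations requires a bijection, hence the
-- insistence on maximal runs and on one fixed direction for runs of a single value.

fromℕ : ℕ → ℚ
fromℕ n = ℤ.+ n / 1

private
  toℚᵘ-/ : ∀ m d → toℚᵘ (ℤ.+ m / suc d) ℚᵘ.≃ ℚᵘ.mkℚᵘ (ℤ.+ m) d
  toℚᵘ-/ m d = ℚ.toℚᵘ-fromℚᵘ (ℚᵘ.mkℚᵘ (ℤ.+ m) d)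

fromℕ-+ : ∀ m n → fromℕ (m + n) ≡ fromℕ m +ℚ fromℕ n
fromℕ-+ m n = ℚ.toℚᵘ-injective (begin
  toℚᵘ (fromℕ (m + n))                            ≈⟨ toℚᵘ-/ (m + n) 0 ⟩
  ℚᵘ.mkℚᵘ (ℤ.+ (m + n)) 0                           ≡⟨ cong (λ z → ℚᵘ.mkℚᵘ z 0) (sym (cong₂ ℤ._+_ (ℤ.*-identityʳ (ℤ.+ m)) (ℤ.*-identityʳ (ℤ.+ n)))) ⟩
  ℚᵘ.mkℚᵘ (ℤ.+ m) 0 ℚᵘ.+ ℚᵘ.mkℚᵘ (ℤ.+ n) 0            ≈⟨ ℚᵘ.+-cong (toℚᵘ-/ m 0) (toℚᵘ-/ n 0) ⟨
  toℚᵘ (fromℕ m) ℚᵘ.+ toℚᵘ (fromℕ n)              ≈⟨ ℚ.toℚᵘ-homo-+ (fromℕ m) (fromℕ n) ⟨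
  toℚᵘ (fromℕ m +ℚ fromℕ n) ∎)
  where open ℚᵘ.≃-Reasoning

recip : ℕ → ℚ
recip j = ℤ.+ 1 / suc j

recip-inverse : ∀ j → recip j *ℚ fromℕ (suc j) ≡ 1ℚ
recip-inverse j = ℚ.toℚᵘ-injective (begin
  toℚᵘ (recip j *ℚ fromℕ (suc j))                 ≈⟨ ℚ.toℚᵘ-homo-* (recip j) (fromℕ (suc j)) ⟩
  toℚᵘ (recip j) ℚᵘ.* toℚᵘ (fromℕ (suc j))        ≈⟨ ℚᵘ.*-cong (toℚᵘ-/ 1 j) (toℚᵘ-/ (suc j) 0) ⟩
  ℚᵘ.mkℚᵘ (ℤ.+ 1) j ℚᵘ.* ℚᵘ.mkℚᵘ (ℤ.+ suc j) 0        ≈⟨ ℚᵘ.*≡* (trans (ℤ.*-identityʳ _) (trans (ℤ.*-identityˡ (ℤ.+ suc j)) (trans (cong ℤ.+_ (sym (*-identityʳ (suc j)))) (sym (ℤ.*-identityˡ _))))) ⟩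
  toℚᵘ 1ℚ ∎)
  where open ℚᵘ.≃-Reasoning

addP : List ℚ → List ℚ → List ℚ
addP []      q       = q
addP (a ∷ p) []      = a ∷ p
addP (a ∷ p) (b ∷ q) = (a +ℚ b) ∷ addP p q

scaleP : ℚ → List ℚ → List ℚ
scaleP k = map (k *ℚ_)

shiftMulP : ℕ → List ℚ → List ℚ
shiftMulP a p = addP (0ℚ ∷ p) (scaleP (-ℚ fromℕ a) p)

evalPoly-add : ∀ p q n → evalPoly (addP p q) n ≡ evalPoly p n +ℚ evalPoly q n
evalPoly-add []      q       n = sym (ℚ.+-identityˡ _)
evalPoly-add (a ∷ p) []      n = sym (ℚ.+-identityʳ _)
evalPoly-add (a ∷ p) (b ∷ q) n rewrite evalPoly-add p q n =
  solve 5 (λ a b x p q → (a :+ b) :+ x :* (p :+ q) := (a :+ x :* p) :+ (b :+ x :* q)) refl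
    a b (fromℕ n) (evalPoly p n) (evalPoly q n)
  where open ℚSolver.+-*-Solver

evalPoly-scale : ∀ k p n → evalPoly (scaleP k p) n ≡ k *ℚ evalPoly p n
evalPoly-scale k []      n = sym (ℚ.*-zeroʳ k)
evalPoly-scale k (a ∷ p) n rewrite evalPoly-scale k p n =
  solve 4 (λ k a x p → k :* a :+ x :* (k :* p) := k :* (a :+ x :* p)) refl
    k a (fromℕ n) (evalPoly p n)
  where open ℚSolver.+-*-Solver

evalPoly-shiftMul : ∀ a p n → evalPoly (shiftMulP a p) n ≡ evalPoly p n *ℚ (fromℕ n -ℚ fromℕ a)
evalPoly-shiftMul a p n rewrite evalPoly-add (0ℚ ∷ p) (scaleP (-ℚ fromℕ a) p) n
  | evalPoly-scale (-ℚ fromℕ a) p n =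
  solve 3 (λ x p a → (con 0ℚ :+ x :* p) :+ (:- a) :* p := p :* (x :- a)) refl
    (fromℕ n) (evalPoly p n) (fromℕ a)
  where open ℚSolver.+-*-Solver

-- The polynomial taking the value C(i, j) at the point N + i.
binomP : ℕ → ℕ → List ℚ
binomP N zero    = 1ℚ ∷ []
binomP N (suc j) = scaleP (recip j) (shiftMulP (N + j) (binomP N j))

module _ (N : ℕ) where

  open ℚSolver.+-*-Solver

  private
    β : ℕ → ℕ → ℚ
    β j i = evalPoly (binomP N j) (N + i)

  β-zero : ∀ i → β 0 i ≡ 1ℚ
  β-zero i = trans (cong (1ℚ +ℚ_) (ℚ.*-zeroʳ (fromℕ (N + i)))) refl

  β-rec : ∀ j i → β (suc j) i ≡ recip j *ℚ (β j i *ℚ (fromℕ i -ℚ fromℕ j))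
  β-rec j i = trans (evalPoly-scale (recip j) (shiftMulP (N + j) (binomP N j)) (N + i))
    (cong (recip j *ℚ_) (trans (evalPoly-shiftMul (N + j) (binomP N j) (N + i))
      (cong (β j i *ℚ_) (trans (cong₂ _-ℚ_ (fromℕ-+ N i) (fromℕ-+ N j))
        (solve 3 (λ n i j → (n :+ i) :- (n :+ j) := i :- j) refl (fromℕ N) (fromℕ i) (fromℕ j))))))

  -- The absorption identity for binomial coefficients, free of division.
  β-absorb : ∀ j i → fromℕ (suc j) *ℚ β (suc j) i ≡ β j i *ℚ (fromℕ i -ℚ fromℕ j)
  β-absorb j i = begin
    f *ℚ β (suc j) i            ≡⟨ cong (f *ℚ_) (β-rec j i) ⟩
    f *ℚ (recip j *ℚ y)         ≡⟨ solve 3 (λ f r y → f :* (r :* y) := (r :* f) :* y) refl f (recip j) y ⟩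
    (recip j *ℚ f) *ℚ y         ≡⟨ cong (_*ℚ y) (recip-inverse j) ⟩
    1ℚ *ℚ y                     ≡⟨ ℚ.*-identityˡ y ⟩
    y ∎
    where
      open ≡-Reasoning
      f = fromℕ (suc j)
      y = β j i *ℚ (fromℕ i -ℚ fromℕ j)

  β-at-zero : ∀ j → β (suc j) 0 ≡ 0ℚ
  β-at-zero zero = trans (β-rec 0 0) (trans (cong (recip 0 *ℚ_) (ℚ.*-zeroʳ (β 0 0))) (ℚ.*-zeroʳ (recip 0)))
  β-at-zero (suc j) = trans (β-rec (suc j) 0) (trans (cong (λ z → recip (suc j) *ℚ (z *ℚ (fromℕ 0 -ℚ fromℕ (suc j)))) (β-at-zero j))
    (trans (cong (recip (suc j) *ℚ_) (ℚ.*-zeroˡ (fromℕ 0 -ℚ fromℕ (suc j)))) (ℚ.*-zeroʳ (recip (suc j)))))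

  cancel-suc : ∀ j {x y} → fromℕ (suc j) *ℚ x ≡ fromℕ (suc j) *ℚ y → x ≡ y
  cancel-suc j {x} {y} eq = trans (sym (lem x)) (trans (cong (recip j *ℚ_) eq) (lem y))
    where
      lem : ∀ z → recip j *ℚ (fromℕ (suc j) *ℚ z) ≡ z
      lem z = trans (sym (ℚ.*-assoc (recip j) (fromℕ (suc j)) z)) (trans (cong (_*ℚ z) (recip-inverse j)) (ℚ.*-identityˡ z))

  -- Induction on `j`: after multiplication by the lower index, absorption expresses each binomial
  -- through the preceding level, where the rule is already known. A ring identity remains, and the
  -- factor is cancelled.
  β-pascal : ∀ j i → β (suc j) (suc i) ≡ β (suc j) i +ℚ β j i
  β-pascal zero i = cancel-suc 0 (begin
    fromℕ 1 *ℚ β 1 (suc i)                         ≡⟨ β-absorb 0 (suc i) ⟩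
    β 0 (suc i) *ℚ (fromℕ (suc i) -ℚ fromℕ 0)      ≡⟨ cong₂ (λ a b → a *ℚ (b -ℚ fromℕ 0)) (β-zero (suc i)) (fromℕ-+ 1 i) ⟩
    1ℚ *ℚ ((fromℕ 1 +ℚ fromℕ i) -ℚ fromℕ 0)        ≡⟨ solve 1 (λ x → con 1ℚ :* ((con 1ℚ :+ x) :- con 0ℚ) := con 1ℚ :* (x :- con 0ℚ) :+ con 1ℚ :* con 1ℚ) refl (fromℕ i) ⟩
    1ℚ *ℚ (fromℕ i -ℚ fromℕ 0) +ℚ 1ℚ *ℚ 1ℚ         ≡⟨ cong₂ _+ℚ_ (cong (_*ℚ (fromℕ i -ℚ fromℕ 0)) (β-zero i)) (cong (1ℚ *ℚ_) (β-zero i)) ⟨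
    β 0 i *ℚ (fromℕ i -ℚ fromℕ 0) +ℚ 1ℚ *ℚ β 0 i   ≡⟨ cong (_+ℚ 1ℚ *ℚ β 0 i) (β-absorb 0 i) ⟨
    fromℕ 1 *ℚ β 1 i +ℚ fromℕ 1 *ℚ β 0 i           ≡⟨ ℚ.*-distribˡ-+ (fromℕ 1) (β 1 i) (β 0 i) ⟨
    fromℕ 1 *ℚ (β 1 i +ℚ β 0 i) ∎)
    where open ≡-Reasoning
  β-pascal (suc j) i = cancel-suc (suc j) (begin
    F *ℚ β (2 + j) (suc i)                         ≡⟨ β-absorb (suc j) (suc i) ⟩
    β (suc j) (suc i) *ℚ (fromℕ (suc i) -ℚ f)      ≡⟨ cong₂ (λ a b → a *ℚ (b -ℚ f)) (β-pascal j i) (fromℕ-+ 1 i) ⟩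
    (b₁ +ℚ b₀) *ℚ ((1ℚ +ℚ x) -ℚ f)                 ≡⟨ cong (λ f → (b₁ +ℚ b₀) *ℚ ((1ℚ +ℚ x) -ℚ f)) (fromℕ-+ 1 j) ⟩
    (b₁ +ℚ b₀) *ℚ ((1ℚ +ℚ x) -ℚ (1ℚ +ℚ y))         ≡⟨ solve 4 (λ b₁ b₀ x y → (b₁ :+ b₀) :* ((con 1ℚ :+ x) :- (con 1ℚ :+ y)) := b₁ :* (x :- y) :+ b₀ :* (x :- y)) refl b₁ b₀ x y ⟩
    b₁ *ℚ (x -ℚ y) +ℚ b₀ *ℚ (x -ℚ y)               ≡⟨ cong (b₁ *ℚ (x -ℚ y) +ℚ_) (trans (sym (β-absorb j i)) (cong (_*ℚ b₁) (fromℕ-+ 1 j))) ⟩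
    b₁ *ℚ (x -ℚ y) +ℚ (1ℚ +ℚ y) *ℚ b₁              ≡⟨ solve 3 (λ b₁ x y → b₁ :* (x :- y) :+ (con 1ℚ :+ y) :* b₁ := b₁ :* (x :- (con 1ℚ :+ y)) :+ (con 1ℚ :+ (con 1ℚ :+ y)) :* b₁) refl b₁ x y ⟩
    b₁ *ℚ (x -ℚ (1ℚ +ℚ y)) +ℚ (1ℚ +ℚ (1ℚ +ℚ y)) *ℚ b₁ ≡⟨ cong₂ (λ s t → b₁ *ℚ (x -ℚ s) +ℚ t *ℚ b₁) (sym (fromℕ-+ 1 j)) (sym (trans (fromℕ-+ 1 (suc j)) (cong (1ℚ +ℚ_) (fromℕ-+ 1 j)))) ⟩
    b₁ *ℚ (x -ℚ f) +ℚ F *ℚ b₁                      ≡⟨ cong (_+ℚ F *ℚ b₁) (β-absorb (suc j) i) ⟨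
    F *ℚ β (2 + j) i +ℚ F *ℚ b₁                    ≡⟨ ℚ.*-distribˡ-+ F (β (2 + j) i) b₁ ⟨
    F *ℚ (β (2 + j) i +ℚ b₁) ∎)
    where
      open ≡-Reasoning
      F = fromℕ (2 + j)
      f = fromℕ (suc j)
      b₁ = β (suc j) i
      b₀ = β j i
      x = fromℕ i
      y = fromℕ j

  -- The offset `j` serves the induction on the list: the tail of a coefficient list is a series
  -- that starts one binomial later.
  newtonP : ℕ → List ℕ → List ℚ
  newtonP j []       = []
  newtonP j (c ∷ cs) = addP (scaleP (fromℕ c) (binomP N j)) (newtonP (suc j) cs)

  newtonP-∷ : ∀ j c cs i → evalPoly (newtonP j (c ∷ cs)) (N + i) ≡ fromℕ c *ℚ β j i +ℚ evalPoly (newtonP (suc j) cs) (N + i)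
  newtonP-∷ j c cs i = trans (evalPoly-add (scaleP (fromℕ c) (binomP N j)) _ (N + i)) (cong (_+ℚ _) (evalPoly-scale (fromℕ c) (binomP N j) (N + i)))

  newtonP-at-zero : ∀ j cs → evalPoly (newtonP (suc j) cs) (N + 0) ≡ 0ℚ
  newtonP-at-zero j []       = refl
  newtonP-at-zero j (c ∷ cs) = trans (newtonP-∷ (suc j) c cs 0)
    (trans (cong₂ _+ℚ_ (trans (cong (fromℕ c *ℚ_) (β-at-zero j)) (ℚ.*-zeroʳ (fromℕ c))) (newtonP-at-zero (suc j) cs)) refl)

  newtonP-pascal : ∀ j cs i → evalPoly (newtonP (suc j) cs) (N + suc i)
                  ≡ evalPoly (newtonP (suc j) cs) (N + i) +ℚ evalPoly (newtonP j cs) (N + i)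
  newtonP-pascal j []       i = refl
  newtonP-pascal j (c ∷ cs) i = begin
    evalPoly (newtonP (suc j) (c ∷ cs)) (N + suc i)  ≡⟨ newtonP-∷ (suc j) c cs (suc i) ⟩
    k *ℚ β (suc j) (suc i) +ℚ evalPoly (newtonP (2 + j) cs) (N + suc i) ≡⟨ cong₂ (λ a b → k *ℚ a +ℚ b) (β-pascal j i) (newtonP-pascal (suc j) cs i) ⟩
    k *ℚ (b₁ +ℚ b₀) +ℚ (e₁ +ℚ e₀)                   ≡⟨ solve 5 (λ k b₁ b₀ e₁ e₀ → k :* (b₁ :+ b₀) :+ (e₁ :+ e₀) := (k :* b₁ :+ e₁) :+ (k :* b₀ :+ e₀)) refl k b₁ b₀ e₁ e₀ ⟩
    (k *ℚ b₁ +ℚ e₁) +ℚ (k *ℚ b₀ +ℚ e₀)              ≡⟨ cong₂ _+ℚ_ (newtonP-∷ (suc j) c cs i) (newtonP-∷ j c cs i) ⟨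
    evalPoly (newtonP (suc j) (c ∷ cs)) (N + i) +ℚ evalPoly (newtonP j (c ∷ cs)) (N + i) ∎
    where
      open ≡-Reasoning
      k = fromℕ c
      b₁ = β (suc j) i
      b₀ = β j i
      e₁ = evalPoly (newtonP (2 + j) cs) (N + i)
      e₀ = evalPoly (newtonP (suc j) cs) (N + i)

-- newton (c₀ ∷ c₁ ∷ …) i = Σⱼ cⱼ · C(i, j), computed by Pascal's rule.
newton : List ℕ → ℕ → ℕ
newton []       i       = 0
newton (c ∷ cs) zero    = c
newton (c ∷ cs) (suc i) = newton (c ∷ cs) i + newton cs i

newtonP-correct : ∀ N cs i → fromℕ (newton cs i) ≡ evalPoly (newtonP N 0 cs) (N + i)
newtonP-correct N []       i = refl
newtonP-correct N (c ∷ cs) zero = sym (trans (newtonP-∷ N 0 c cs 0)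
  (trans (cong₂ _+ℚ_ (trans (cong (fromℕ c *ℚ_) (β-zero N 0)) (ℚ.*-identityʳ (fromℕ c))) (newtonP-at-zero N 0 cs)) (ℚ.+-identityʳ (fromℕ c))))
newtonP-correct N (c ∷ cs) (suc i) = begin
  fromℕ (newton (c ∷ cs) i + newton cs i)                  ≡⟨ fromℕ-+ (newton (c ∷ cs) i) (newton cs i) ⟩
  fromℕ (newton (c ∷ cs) i) +ℚ fromℕ (newton cs i)         ≡⟨ cong₂ _+ℚ_ (newtonP-correct N (c ∷ cs) i) (newtonP-correct N cs i) ⟩
  evalPoly (newtonP N 0 (c ∷ cs)) (N + i) +ℚ e₀            ≡⟨ cong (_+ℚ e₀) (newtonP-∷ N 0 c cs i) ⟩
  (k *ℚ b i +ℚ e₁) +ℚ e₀                                   ≡⟨ ℚ.+-assoc (k *ℚ b i) e₁ e₀ ⟩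
  k *ℚ b i +ℚ (e₁ +ℚ e₀)                                   ≡⟨ cong₂ (λ s t → k *ℚ s +ℚ t) (trans (β-zero N i) (sym (β-zero N (suc i)))) (sym (newtonP-pascal N 0 cs i)) ⟩
  k *ℚ b (suc i) +ℚ evalPoly (newtonP N 1 cs) (N + suc i)  ≡⟨ newtonP-∷ N 0 c cs (suc i) ⟨
  evalPoly (newtonP N 0 (c ∷ cs)) (N + suc i) ∎
  where
    open ≡-Reasoning
    k = fromℕ c
    b : ℕ → ℚ
    b i = evalPoly (binomP N 0) (N + i)
    e₀ = evalPoly (newtonP N 0 cs) (N + i)
    e₁ = evalPoly (newtonP N 1 cs) (N + i)

-- Newton coefficients from the threshold onwards are used instead of powers of n: a cumulative sum
-- then merely prepends a coefficient, and all coefficients stay natural numbers. Rationals enter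
-- only in the final conversion.
record EventuallyPoly (f : ℕ → ℕ) : Set where
  constructor eventually
  field
    threshold : ℕ
    coeffs    : List ℕ
    agreement : ∀ i → f (threshold + i) ≡ newton coeffs i

addC : List ℕ → List ℕ → List ℕ
addC []       ds       = ds
addC (c ∷ cs) []       = c ∷ cs
addC (c ∷ cs) (d ∷ ds) = (c + d) ∷ addC cs ds

newton-add : ∀ cs ds i → newton (addC cs ds) i ≡ newton cs i + newton ds i
newton-add []       ds       i       = refl
newton-add (c ∷ cs) []       i       = sym (+-identityʳ _)
newton-add (c ∷ cs) (d ∷ ds) zero    = refl
newton-add (c ∷ cs) (d ∷ ds) (suc i) rewrite newton-add (c ∷ cs) (d ∷ ds) i | newton-add cs ds i =
  solve 4 (λ a b c d → (a :+ b) :+ (c :+ d) := (a :+ c) :+ (b :+ d)) refl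
    (newton (c ∷ cs) i) (newton (d ∷ ds) i) (newton cs i) (newton ds i)
  where open +-*-Solver

tailC : List ℕ → List ℕ
tailC []       = []
tailC (c ∷ cs) = cs

-- By Pascal's rule, moving the origin by one adds to each coefficient its successor in the list.
shiftC : ℕ → List ℕ → List ℕ
shiftC zero    cs = cs
shiftC (suc m) cs = shiftC m (addC cs (tailC cs))

newton-shift : ∀ m cs i → newton (shiftC m cs) i ≡ newton cs (m + i)
newton-shift zero    cs i = refl
newton-shift (suc m) cs i = trans (newton-shift m _ i) (trans (newton-add cs (tailC cs) (m + i)) (lem cs (m + i)))
  where
    lem : ∀ cs n → newton cs n + newton (tailC cs) n ≡ newton cs (suc n)
    lem []       n = refl
    lem (c ∷ cs) n = refl

module _ {f g : ℕ → ℕ} where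

  eventually-cong : (∀ n → f n ≡ g n) → EventuallyPoly g → EventuallyPoly f
  eventually-cong eq (eventually N cs h) = eventually N cs λ i → trans (eq (N + i)) (h i)

  eventually-+ : EventuallyPoly f → EventuallyPoly g → EventuallyPoly (λ n → f n + g n)
  eventually-+ (eventually N cs hf) (eventually M ds hg) = eventually (N + M) (addC (shiftC M cs) (shiftC N ds)) λ i → begin
    f (N + M + i) + g (N + M + i)                        ≡⟨ cong₂ (λ a b → f a + g b) (+-assoc N M i) (trans (cong (_+ i) (+-comm N M)) (+-assoc M N i)) ⟩
    f (N + (M + i)) + g (M + (N + i))                    ≡⟨ cong₂ _+_ (hf (M + i)) (hg (N + i)) ⟩
    newton cs (M + i) + newton ds (N + i)                ≡⟨ cong₂ _+_ (newton-shift M cs i) (newton-shift N ds i) ⟨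
    newton (shiftC M cs) i + newton (shiftC N ds) i      ≡⟨ newton-add (shiftC M cs) (shiftC N ds) i ⟨
    newton (addC (shiftC M cs) (shiftC N ds)) i ∎
    where open ≡-Reasoning

  eventually-suc : (∀ n → f (suc n) ≡ g n) → EventuallyPoly g → EventuallyPoly f
  eventually-suc eq (eventually N cs h) = eventually (suc N) cs λ i → trans (eq (N + i)) (h i)

  -- Summation raises the lower index of every binomial by one; the constant of summation is the
  -- value `f N` at the threshold.
  eventually-sum : (∀ n → f (suc n) ≡ g n + f n) → EventuallyPoly g → EventuallyPoly f
  eventually-sum eq (eventually N cs h) = eventually N (f N ∷ cs) go
    where
      go : ∀ i → f (N + i) ≡ newton (f N ∷ cs) i
      go zero    = cong f (+-identityʳ N)
      go (suc i) = trans (cong f (+-suc N i)) (trans (eq (N + i)) (trans (cong₂ _+_ (h i) (go i)) (+-comm (newton cs i) _)))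

-- The value at 0 is left free because the empty word has total 0.
eventually-zero : ∀ {f : ℕ → ℕ} → (∀ n → f (suc n) ≡ 0) → EventuallyPoly f
eventually-zero eq = eventually 1 [] eq

eventuallyPoly⇒evalPoly : ∀ {f} → EventuallyPoly f →
  ∃[ p ] ∃[ N ] (∀ n → N ≤ n → fromℕ (f n) ≡ evalPoly p n)
eventuallyPoly⇒evalPoly {f} (eventually N cs h) = newtonP N 0 cs , N , λ n N≤n →
  let i , eq = m≤n⇒∃[o]m+o≡n N≤n in
  trans (cong (λ n → fromℕ (f n)) (sym eq)) (trans (cong fromℕ (h i)) (trans (newtonP-correct N cs i) (cong (evalPoly (newtonP N 0 cs)) eq)))

-- Counting words by their total multiplicity

module _ {A B : Set} {P : B → Set} (P? : Decidable P) (f : A → B) where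

  length-filter-map : ∀ xs → length (filter P? (map f xs)) ≡ length (filter (P? ∘ f) xs)
  length-filter-map [] = refl
  length-filter-map (x ∷ xs) with P? (f x)
  ... | yes _ = cong suc (length-filter-map xs)
  ... | no  _ = length-filter-map xs

length-filter-cong : ∀ {A : Set} {P Q : A → Set} (P? : Decidable P) (Q? : Decidable Q) {xs} →
  All (λ x → P x ⇔ Q x) xs → length (filter P? xs) ≡ length (filter Q? xs)
length-filter-cong P? Q? [] = refl
length-filter-cong P? Q? {x ∷ _} (eq ∷ eqs) with P? x | Q? x
... | yes _ | yes _ = cong suc (length-filter-cong P? Q? eqs)
... | no  _ | no  _ = length-filter-cong P? Q? eqs
... | yes p | no ¬q = contradiction (to eq p) ¬q
... | no ¬p | yes q = contradiction (from eq q) ¬p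

length-filter-++ : ∀ {A : Set} {P : A → Set} (P? : Decidable P) xs ys →
  length (filter P? (xs ++ ys)) ≡ length (filter P? xs) + length (filter P? ys)
length-filter-++ P? xs ys = trans (cong length (filter-++ P? xs ys)) (length-++ (filter P? xs))

-- A letter α with multiplicity suc e is written (α , e).
Word : Set → Set
Word A = List (A × ℕ)

total : ∀ {A} → Word A → ℕ
total []            = 0
total ((_ , e) ∷ c) = suc e + total c

-- Equivalently, `P` sees each exponent `e` only through its minimum with `B`.
Stable : ∀ {A} → ℕ → (Word A → Set) → Set
Stable B P = ∀ pre α e post → B ≤ e → P (pre ++ (α , e) ∷ post) ⇔ P (pre ++ (α , suc e) ∷ post)

grow : ∀ {A} → Word A → Word A
grow []            = []
grow ((α , e) ∷ c) = (α , suc e) ∷ c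

grow-injective : ∀ {A} {c d : Word A} → grow c ≡ grow d → c ≡ d
grow-injective {c = []}    {[]}    eq   = refl
grow-injective {c = _ ∷ _} {_ ∷ _} refl = refl

module _ {A : Set} (letters : List A) where

  -- One unit is taken off the first letter: either the letter disappears or its multiplicity drops.
  -- On cardinalities this is the recurrence of a cumulative sum, the form that `eventually-sum`
  -- accepts.
  words : ℕ → ℕ → List (Word A)
  words zero    zero    = [] ∷ []
  words zero    (suc n) = []
  words (suc m) zero    = []
  words (suc m) (suc n) = cartesianProductWith (λ α c → (α , 0) ∷ c) letters (words m n) ++ map grow (words (suc m) n)

  ∈-words⁻ : ∀ m n {c} → c ∈ words m n → length c ≡ m × total c ≡ n
  ∈-words⁻ zero zero (here refl) = refl , refl
  ∈-words⁻ (suc m) (suc n) c∈ with ∈-++⁻ (cartesianProductWith _ letters (words m n)) c∈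
  ... | inj₁ c∈₁ with _ , _ , _ , d∈ , refl ← ∈-cartesianProductWith⁻ _ letters (words m n) c∈₁
                 with refl , refl ← ∈-words⁻ m n d∈ = refl , refl
  ... | inj₂ c∈₂ with d , d∈ , refl ← ∈-map⁻ grow c∈₂ = lem d (∈-words⁻ (suc m) n d∈)
    where
      lem : ∀ d → length d ≡ suc m × total d ≡ n → length (grow d) ≡ suc m × total (grow d) ≡ suc n
      lem (_ ∷ d) (refl , refl) = refl , refl

  ∈-words⁺ : ∀ {c} → All (λ x → proj₁ x ∈ letters) c → c ∈ words (length c) (total c)
  ∈-words⁺ [] = here refl
  ∈-words⁺ {(α , zero)  ∷ c} (α∈ ∷ c∈) = ∈-++⁺ˡ (∈-cartesianProductWith⁺ _ α∈ (∈-words⁺ c∈))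
  ∈-words⁺ {(α , suc e) ∷ c} (α∈ ∷ c∈) =
    ∈-++⁺ʳ (cartesianProductWith _ letters (words (length c) (suc e + total c))) (∈-map⁺ grow (∈-words⁺ (α∈ ∷ c∈)))

  words-unique : Unique letters → ∀ m n → Unique (words m n)
  words-unique u zero    zero    = [] ∷ []
  words-unique u zero    (suc n) = []
  words-unique u (suc m) zero    = []
  words-unique u (suc m) (suc n) = Unique.++⁺
    (Unique.cartesianProductWith⁺ (λ α c → (α , 0) ∷ c) (λ { refl → refl , refl }) u (words-unique u m n))
    (Unique.map⁺ grow-injective (words-unique u (suc m) n))
    disjoint
    where
      disjoint : ∀ {c} → ¬ (c ∈ cartesianProductWith (λ α c → (α , 0) ∷ c) letters (words m n) × c ∈ map grow (words (suc m) n))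
      disjoint (c∈₁ , c∈₂)
        with _ , _ , _ , _ , refl ← ∈-cartesianProductWith⁻ _ letters (words m n) c∈₁
        with [] , _ , () ← ∈-map⁻ grow c∈₂

  eventually-product : ∀ {P : Word A → Set} (P? : Decidable P) (f : A → Word A → Word A) (K : ℕ → List (Word A)) →
    (∀ α → EventuallyPoly (λ n → length (filter (P? ∘ f α) (K n)))) → ∀ ls →
    EventuallyPoly (λ n → length (filter P? (cartesianProductWith f ls (K n))))
  eventually-product P? f K h []       = eventually-zero (λ n → refl)
  eventually-product P? f K h (α ∷ ls) = eventually-cong
    (λ n → trans (length-filter-++ P? (map (f α) (K n)) _) (cong (_+ _) (length-filter-map P? (f α) (K n))))
    (eventually-+ (h α) (eventually-product P? f K h ls))

  -- Induction on the number of letters: with the first letter fixed at multiplicity one, the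
  -- remaining word ranges over a stable set of shorter words, and there are finitely many choices
  -- for that letter.
  words-eventuallyPoly : ∀ m B {P : Word A → Set} (P? : Decidable P) → Stable B P →
    EventuallyPoly (λ n → length (filter P? (words m n)))
  words-eventuallyPoly zero    B     P? stable = eventually-zero (λ n → refl)
  words-eventuallyPoly (suc m) B {P} P? stable = go B P? (λ α e post → stable [] α e post) (λ x pre → stable (x ∷ pre))
    where
      -- Induction on the threshold b of the first multiplicity; once b = 0 the words
      -- with positive first multiplicity are counted by a cumulative sum.
      go : ∀ b {P : Word A → Set} (P? : Decidable P) →
        (∀ α e post → b ≤ e → P ((α , e) ∷ post) ⇔ P ((α , suc e) ∷ post)) →
        (∀ x pre α e post → B ≤ e → P (x ∷ pre ++ (α , e) ∷ post) ⇔ P (x ∷ pre ++ (α , suc e) ∷ post)) →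
        EventuallyPoly (λ n → length (filter P? (words (suc m) n)))
      go b {P} P? head tail = split b head
        where
          firstOne : EventuallyPoly (λ n → length (filter P? (cartesianProductWith (λ α c → (α , 0) ∷ c) letters (words m n))))
          firstOne = eventually-product P? (λ α c → (α , 0) ∷ c) (words m)
            (λ α → words-eventuallyPoly m B (λ c → P? ((α , 0) ∷ c)) (λ pre → tail (α , 0) pre)) letters
          unroll : ∀ n → length (filter P? (words (suc m) (suc n))) ≡
                         length (filter P? (cartesianProductWith (λ α c → (α , 0) ∷ c) letters (words m n)))
                         + length (filter (P? ∘ grow) (words (suc m) n))
          unroll n = trans (length-filter-++ P? (cartesianProductWith (λ α c → (α , 0) ∷ c) letters (words m n)) _)
            (cong (length (filter P? (cartesianProductWith (λ α c → (α , 0) ∷ c) letters (words m n))) +_) (length-filter-map P? grow (words (suc m) n)))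
          split : ∀ b → (∀ α e post → b ≤ e → P ((α , e) ∷ post) ⇔ P ((α , suc e) ∷ post)) →
                  EventuallyPoly (λ n → length (filter P? (words (suc m) n)))
          split zero    head = eventually-sum
            (λ n → trans (unroll n) (cong (length (filter P? (cartesianProductWith (λ α c → (α , 0) ∷ c) letters (words m n))) +_)
              (length-filter-cong (P? ∘ grow) P? (All.universal (λ { [] → ⇔-id _ ; ((α , e) ∷ c) → ⇔-sym (head α e c z≤n) }) (words (suc m) n)))))
            firstOne
          -- Words whose first multiplicity exceeds one are counted through `P? ∘ grow`, whose
          -- threshold at the first letter is one lower; the later letters keep the threshold `B`.
          split (suc b) head = eventually-suc unroll
            (eventually-+ firstOne (go b (P? ∘ grow) (λ α e post b≤e → head α (suc e) post (s≤s b≤e))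
              (λ { (β , x) pre α e post B≤e → tail (β , suc x) pre α e post B≤e })))

  wordsUpTo : ℕ → ℕ → List (Word A)
  wordsUpTo zero    n = words zero n
  wordsUpTo (suc m) n = words (suc m) n ++ wordsUpTo m n

  ∈-wordsUpTo⁻ : ∀ m n {c} → c ∈ wordsUpTo m n → length c ≤ m × total c ≡ n
  ∈-wordsUpTo⁻ zero    n c∈ = let l , t = ∈-words⁻ zero n c∈ in ≤-reflexive l , t
  ∈-wordsUpTo⁻ (suc m) n c∈ with ∈-++⁻ (words (suc m) n) c∈
  ... | inj₁ c∈₁ = let l , t = ∈-words⁻ (suc m) n c∈₁ in ≤-reflexive l , t
  ... | inj₂ c∈₂ = let l , t = ∈-wordsUpTo⁻ m n c∈₂ in m≤n⇒m≤1+n l , t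

  ∈-wordsUpTo⁺ : ∀ {m c} → length c ≤ m → All (λ x → proj₁ x ∈ letters) c → c ∈ wordsUpTo m (total c)
  ∈-wordsUpTo⁺ {m} {c} l c∈ = go m l
    where
      go : ∀ m → length c ≤ m → c ∈ wordsUpTo m (total c)
      go zero    l = subst (λ m → c ∈ words m (total c)) (n≤0⇒n≡0 l) (∈-words⁺ c∈)
      go (suc m) l with m≤n⇒m<n∨m≡n l
      ... | inj₁ (s≤s l′) = ∈-++⁺ʳ (words (suc m) (total c)) (go m l′)
      ... | inj₂ eq       = ∈-++⁺ˡ (subst (λ m → c ∈ words m (total c)) eq (∈-words⁺ c∈))

  wordsUpTo-unique : Unique letters → ∀ m n → Unique (wordsUpTo m n)
  wordsUpTo-unique u zero    n = words-unique u zero n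
  wordsUpTo-unique u (suc m) n = Unique.++⁺ (words-unique u (suc m) n) (wordsUpTo-unique u m n)
    (λ { (c∈₁ , c∈₂) → 1+n≰n (subst (_≤ m) (proj₁ (∈-words⁻ (suc m) n c∈₁)) (proj₁ (∈-wordsUpTo⁻ m n c∈₂))) })

  wordsUpTo-eventuallyPoly : ∀ m B {P : Word A → Set} (P? : Decidable P) → Stable B P →
    EventuallyPoly (λ n → length (filter P? (wordsUpTo m n)))
  wordsUpTo-eventuallyPoly zero    B P? stable = words-eventuallyPoly zero B P? stable
  wordsUpTo-eventuallyPoly (suc m) B P? stable = eventually-cong
    (λ n → length-filter-++ P? (words (suc m) n) (wordsUpTo m n))
    (eventually-+ (words-eventuallyPoly (suc m) B P? stable) (wordsUpTo-eventuallyPoly m B P? stable))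

-- Signed sorting sequences and blow-ups

-- Both directions are indexed by the smallest value, so reversal changes nothing but the Boolean.
run : Bool → ℕ → ℕ → List ℕ
run true  b zero    = []
run true  b (suc n) = b ∷ run true (suc b) n
run false b zero    = []
run false b (suc n) = b + n ∷ run false b n

run-true-++ : ∀ b m n → run true b (m + n) ≡ run true b m ++ run true (b + m) n
run-true-++ b zero    n = cong (λ b → run true b n) (sym (+-identityʳ b))
run-true-++ b (suc m) n = cong (b ∷_) (trans (run-true-++ (suc b) m n)
  (cong (λ c → run true (suc b) m ++ run true c n) (sym (+-suc b m))))

run-false-++ : ∀ b m n → run false b (m + n) ≡ run false (b + m) n ++ run false b m
run-false-++ b m zero    = cong (run false b) (+-identityʳ m)
run-false-++ b m (suc n) = trans (cong (run false b) (+-suc m n))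
  (cong₂ _∷_ (sym (+-assoc b m n)) (run-false-++ b m n))

-- Up to length one the direction is invisible. This frees every value of weight at most one from
-- conditions on its sign.
run-short : ∀ σ τ b {n} → n ≤ 1 → run σ b n ≡ run τ b n
run-short σ τ b n≤1 = trans (to-true σ n≤1) (sym (to-true τ n≤1))
  where
    to-true : ∀ σ {n} → n ≤ 1 → run σ b n ≡ run true b n
    to-true true  n≤1       = refl
    to-true false z≤n       = refl
    to-true false (s≤s z≤n) = cong [_] (+-identityʳ b)

reverse-run-true : ∀ b n → reverse (run true b n) ≡ run false b n
reverse-run-true b zero    = refl
reverse-run-true b (suc n) = begin
  reverse (b ∷ run true (suc b) n)           ≡⟨ unfold-reverse b (run true (suc b) n) ⟩
  reverse (run true (suc b) n) ++ [ b ]      ≡⟨ cong (_++ [ b ]) (reverse-run-true (suc b) n) ⟩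
  run false (suc b) n ++ [ b ]               ≡⟨ cong₂ (λ c d → run false c n ++ [ d ]) (+-comm 1 b) (sym (+-identityʳ b)) ⟩
  run false (b + 1) n ++ run false b 1       ≡⟨ run-false-++ b 1 n ⟨
  run false b (suc n) ∎
  where open ≡-Reasoning

reverse-run : ∀ σ b n → reverse (run σ b n) ≡ run (not σ) b n
reverse-run true  b n = reverse-run-true b n
reverse-run false b n = trans (cong reverse (sym (reverse-run-true b n))) (reverse-involutive (run true b n))

length-run : ∀ σ b n → length (run σ b n) ≡ n
length-run true  b zero    = refl
length-run true  b (suc n) = cong suc (length-run true (suc b) n)
length-run false b zero    = refl
length-run false b (suc n) = cong suc (length-run false b n)

sumFrom : (ℕ → ℕ) → ℕ → ℕ → ℕ
sumFrom w b zero    = 0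
sumFrom w b (suc n) = sumFrom w b n + w (b + n)

sumTo : (ℕ → ℕ) → ℕ → ℕ
sumTo w = sumFrom w 0

sumFrom-suc : ∀ w b n → sumFrom w b (suc n) ≡ w b + sumFrom w (suc b) n
sumFrom-suc w b zero    = trans (cong w (+-identityʳ b)) (sym (+-identityʳ (w b)))
sumFrom-suc w b (suc n) = begin
  sumFrom w b (suc n) + w (b + suc n)           ≡⟨ cong₂ _+_ (sumFrom-suc w b n) (cong w (+-suc b n)) ⟩
  w b + sumFrom w (suc b) n + w (suc b + n)     ≡⟨ +-assoc (w b) _ _ ⟩
  w b + (sumFrom w (suc b) n + w (suc b + n)) ∎
  where open ≡-Reasoning

sumTo-+ : ∀ w b n → sumTo w (b + n) ≡ sumTo w b + sumFrom w b n
sumTo-+ w b zero    = trans (cong (sumTo w) (+-identityʳ b)) (sym (+-identityʳ _))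
sumTo-+ w b (suc n) = trans (cong (sumTo w) (+-suc b n)) (trans (cong (_+ w (b + n)) (sumTo-+ w b n)) (+-assoc (sumTo w b) _ _))

-- The sign is false iff the value is reversed an odd number of times on the way to the
-- identity; it determines the direction in which a block inserted for the value is read.
SignedValue : Set
SignedValue = Bool × ℕ

flip : SignedValue → SignedValue
flip (s , x) = not s , x

reverseFlip : List SignedValue → List SignedValue
reverseFlip xs = reverse (map flip xs)

reverseFlip-∷ : ∀ x xs → reverseFlip (x ∷ xs) ≡ reverseFlip xs ++ [ flip x ]
reverseFlip-∷ x xs = unfold-reverse (flip x) (map flip xs)

values : List SignedValue → List ℕ
values = map proj₂

values-reverseFlip : ∀ xs → values (reverseFlip xs) ≡ reverse (values xs)
values-reverseFlip xs = trans (reverse-map proj₂ (map flip xs)) (cong reverse (sym (map-∘ xs)))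

-- Weights w x > 1 duplicate the value x and weight 0 deletes it; since blow commutes
-- with flip and reversal, a sorting sequence can be blown up as a whole.
blow : (ℕ → ℕ) → SignedValue → List ℕ
blow w (s , x) = run s (sumTo w x) (w x)

blowUp : (ℕ → ℕ) → List SignedValue → List ℕ
blowUp w = concatMap (blow w)

blowUp-++ : ∀ w xs ys → blowUp w (xs ++ ys) ≡ blowUp w xs ++ blowUp w ys
blowUp-++ w = concatMap-++ (blow w)

blowUp-++₃ : ∀ w a b c → blowUp w (a ++ b ++ c) ≡ blowUp w a ++ blowUp w b ++ blowUp w c
blowUp-++₃ w a b c = trans (blowUp-++ w a (b ++ c)) (cong (blowUp w a ++_) (blowUp-++ w b c))

blowUp-++₄ : ∀ w a b c d → blowUp w (a ++ b ++ c ++ d) ≡ blowUp w a ++ blowUp w b ++ blowUp w c ++ blowUp w d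
blowUp-++₄ w a b c d = trans (blowUp-++ w a (b ++ c ++ d)) (cong (blowUp w a ++_) (blowUp-++₃ w b c d))

blowUp-++₅ : ∀ w a b c d e → blowUp w (a ++ b ++ c ++ d ++ e) ≡ blowUp w a ++ blowUp w b ++ blowUp w c ++ blowUp w d ++ blowUp w e
blowUp-++₅ w a b c d e = trans (blowUp-++ w a (b ++ c ++ d ++ e)) (cong (blowUp w a ++_) (blowUp-++₄ w b c d e))

blowUp-reverseFlip : ∀ w xs → blowUp w (reverseFlip xs) ≡ reverse (blowUp w xs)
blowUp-reverseFlip w []       = refl
blowUp-reverseFlip w (x ∷ xs) = begin
  blowUp w (reverseFlip (x ∷ xs))                  ≡⟨ cong (blowUp w) (reverseFlip-∷ x xs) ⟩
  blowUp w (reverseFlip xs ++ [ flip x ])          ≡⟨ blowUp-++ w (reverseFlip xs) [ flip x ] ⟩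
  blowUp w (reverseFlip xs) ++ (blow w (flip x) ++ []) ≡⟨ cong₂ _++_ (blowUp-reverseFlip w xs) (++-identityʳ _) ⟩
  reverse (blowUp w xs) ++ blow w (flip x)         ≡⟨ cong (reverse (blowUp w xs) ++_) (reverse-run (proj₁ x) _ _) ⟨
  reverse (blowUp w xs) ++ reverse (blow w x)      ≡⟨ reverse-++ (blow w x) (blowUp w xs) ⟨
  reverse (blowUp w (x ∷ xs)) ∎
  where open ≡-Reasoning

-- The block of each value begins at a prefix sum of the weights, so the blocks of consecutive
-- values are themselves consecutive. A sign has to agree with the direction only where several
-- copies appear.
blowUp-run : ∀ w σ b n xs → values xs ≡ run σ b n → All (λ x → proj₁ x ≡ σ ⊎ w (proj₂ x) ≤ 1) xs →
  blowUp w xs ≡ run σ (sumTo w b) (sumFrom w b n)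
blowUp-run w σ b n xs eq ok = go σ b n xs eq ok
  where
    blow-σ : ∀ {σ x} → proj₁ x ≡ σ ⊎ w (proj₂ x) ≤ 1 → blow w x ≡ run σ (sumTo w (proj₂ x)) (w (proj₂ x))
    blow-σ (inj₁ refl)   = refl
    blow-σ {σ} {s , x} (inj₂ short) = run-short s σ (sumTo w x) short

    go : ∀ σ b n xs → values xs ≡ run σ b n → All (λ x → proj₁ x ≡ σ ⊎ w (proj₂ x) ≤ 1) xs →
         blowUp w xs ≡ run σ (sumTo w b) (sumFrom w b n)
    go true  b zero    []             eq _ = refl
    go false b zero    []             eq _ = refl
    go true  b (suc n) ((s , x) ∷ xs) eq (ok ∷ oks) with refl , eq′ ← ∷-injective eq = begin
      blow w (s , b) ++ blowUp w xs                                         ≡⟨ cong₂ _++_ (blow-σ ok) (go true (suc b) n xs eq′ oks) ⟩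
      run true (sumTo w b) (w b) ++ run true (sumTo w (suc b)) (sumFrom w (suc b) n) ≡⟨ run-true-++ (sumTo w b) (w b) (sumFrom w (suc b) n) ⟨
      run true (sumTo w b) (w b + sumFrom w (suc b) n)                      ≡⟨ cong (run true (sumTo w b)) (sumFrom-suc w b n) ⟨
      run true (sumTo w b) (sumFrom w b (suc n)) ∎
      where open ≡-Reasoning
    go false b (suc n) ((s , x) ∷ xs) eq (ok ∷ oks) with refl , eq′ ← ∷-injective eq = begin
      blow w (s , b + n) ++ blowUp w xs                                     ≡⟨ cong₂ _++_ (blow-σ ok) (go false b n xs eq′ oks) ⟩
      run false (sumTo w (b + n)) (w (b + n)) ++ run false (sumTo w b) (sumFrom w b n) ≡⟨ cong (λ c → run false c (w (b + n)) ++ run false (sumTo w b) (sumFrom w b n)) (sumTo-+ w b n) ⟩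
      run false (sumTo w b + sumFrom w b n) (w (b + n)) ++ run false (sumTo w b) (sumFrom w b n) ≡⟨ run-false-++ (sumTo w b) (sumFrom w b n) (w (b + n)) ⟨
      run false (sumTo w b) (sumFrom w b (suc n)) ∎
      where open ≡-Reasoning

positive : List ℕ → List SignedValue
positive = map (true ,_)

values-positive : ∀ xs → values (positive xs) ≡ xs
values-positive xs = trans (sym (map-∘ xs)) (map-id xs)

upTo≡run : ∀ n → upTo n ≡ run true 0 n
upTo≡run n = trans (sym (map-id _)) (trans (map-upTo (λ x → x) n) (go (λ x → x) 0 n (λ _ → refl)))
  where
    go : ∀ f b n → (∀ x → f x ≡ b + x) → applyUpTo f n ≡ run true b n
    go f b zero    h = refl
    go f b (suc n) h = cong₂ _∷_ (trans (h 0) (+-identityʳ b)) (go (f ∘ suc) (suc b) n (λ x → trans (h (suc x)) (+-suc b x)))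

blowUp-upTo : ∀ w n → blowUp w (positive (upTo n)) ≡ upTo (sumTo w n)
blowUp-upTo w n = trans
  (blowUp-run w true 0 n (positive (upTo n)) (trans (values-positive (upTo n)) (upTo≡run n)) (All.map⁺ (All.universal (λ _ → inj₁ refl) (upTo n))))
  (sym (upTo≡run (sumTo w n)))

-- Signed breakpoints and their growth under one operation

bad : SignedValue → SignedValue → ℕ
bad (true  , x) (true  , y) = if does (y ≟ suc x) then 0 else 1
bad (false , x) (false , y) = if does (x ≟ suc y) then 0 else 1
bad (true  , x) (false , y) = 1
bad (false , x) (true  , y) = 1

-- The breakpoints of signed permutations. An intact pair is `x`, `x + 1` with positive signs or the
-- image of such a pair under reversal with flipped signs, so a reversed block keeps its internal
-- count.
breaks : List SignedValue → ℕ
breaks []           = 0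
breaks (x ∷ [])     = 0
breaks (x ∷ y ∷ xs) = bad x y + breaks (y ∷ xs)

bad≤1 : ∀ x y → bad x y ≤ 1
bad≤1 (true  , x) (true  , y) with does (y ≟ suc x)
... | true  = z≤n
... | false = ≤-refl
bad≤1 (false , x) (false , y) with does (x ≟ suc y)
... | true  = z≤n
... | false = ≤-refl
bad≤1 (true  , x) (false , y) = ≤-refl
bad≤1 (false , x) (true  , y) = ≤-refl

bad-flip : ∀ x y → bad (flip y) (flip x) ≡ bad x y
bad-flip (true  , x) (true  , y) = refl
bad-flip (false , x) (false , y) = refl
bad-flip (true  , x) (false , y) = refl
bad-flip (false , x) (true  , y) = refl

-- Together with `breaks-+-≤`: cutting a list never increases the breaks of its pieces, and
-- rejoining them costs at most one per joint. Only the number of joints matters for each operation.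
breaks-++-≤ : ∀ xs ys → breaks (xs ++ ys) ≤ suc (breaks xs + breaks ys)
breaks-++-≤ []           ys       = n≤1+n (breaks ys)
breaks-++-≤ (x ∷ [])     []       = z≤n
breaks-++-≤ (x ∷ [])     (y ∷ ys) = +-monoˡ-≤ (breaks (y ∷ ys)) (bad≤1 x y)
breaks-++-≤ (x ∷ y ∷ xs) ys       = begin
  bad x y + breaks (y ∷ xs ++ ys)             ≤⟨ +-monoʳ-≤ (bad x y) (breaks-++-≤ (y ∷ xs) ys) ⟩
  bad x y + suc (breaks (y ∷ xs) + breaks ys) ≡⟨ solve 3 (λ a b c → a :+ (con 1 :+ (b :+ c)) := con 1 :+ (a :+ b :+ c)) refl (bad x y) (breaks (y ∷ xs)) (breaks ys) ⟩
  suc (breaks (x ∷ y ∷ xs) + breaks ys) ∎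
  where open ≤-Reasoning; open +-*-Solver

breaks-+-≤ : ∀ xs ys → breaks xs + breaks ys ≤ breaks (xs ++ ys)
breaks-+-≤ []           ys       = ≤-refl
breaks-+-≤ (x ∷ [])     []       = z≤n
breaks-+-≤ (x ∷ [])     (y ∷ ys) = m≤n+m (breaks (y ∷ ys)) (bad x y)
breaks-+-≤ (x ∷ y ∷ xs) ys       = begin
  bad x y + breaks (y ∷ xs) + breaks ys   ≡⟨ +-assoc (bad x y) _ _ ⟩
  bad x y + (breaks (y ∷ xs) + breaks ys) ≤⟨ +-monoʳ-≤ (bad x y) (breaks-+-≤ (y ∷ xs) ys) ⟩
  bad x y + breaks (y ∷ xs ++ ys) ∎
  where open ≤-Reasoning

breaks-∷ʳ : ∀ xs y z → breaks ((xs ++ [ y ]) ++ [ z ]) ≡ breaks (xs ++ [ y ]) + bad y z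
breaks-∷ʳ []            y z = +-identityʳ (bad y z)
breaks-∷ʳ (x ∷ [])      y z = trans (cong (bad x y +_) (+-identityʳ (bad y z))) (cong (_+ bad y z) (sym (+-identityʳ (bad x y))))
breaks-∷ʳ (x ∷ x′ ∷ xs) y z = trans (cong (bad x x′ +_) (breaks-∷ʳ (x′ ∷ xs) y z)) (sym (+-assoc (bad x x′) _ _))

breaks-reverseFlip : ∀ xs → breaks (reverseFlip xs) ≡ breaks xs
breaks-reverseFlip []           = refl
breaks-reverseFlip (x ∷ [])     = refl
breaks-reverseFlip (x ∷ y ∷ xs) = begin
  breaks (reverseFlip (x ∷ y ∷ xs))                          ≡⟨ cong breaks (trans (reverseFlip-∷ x (y ∷ xs)) (cong (_++ [ flip x ]) (reverseFlip-∷ y xs))) ⟩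
  breaks ((reverseFlip xs ++ [ flip y ]) ++ [ flip x ])      ≡⟨ breaks-∷ʳ (reverseFlip xs) (flip y) (flip x) ⟩
  breaks (reverseFlip xs ++ [ flip y ]) + bad (flip y) (flip x) ≡⟨ cong₂ _+_ (trans (cong breaks (sym (reverseFlip-∷ y xs))) (breaks-reverseFlip (y ∷ xs))) (bad-flip x y) ⟩
  breaks (y ∷ xs) + bad x y                                  ≡⟨ +-comm (breaks (y ∷ xs)) (bad x y) ⟩
  breaks (x ∷ y ∷ xs) ∎
  where open ≡-Reasoning

breaks-positive-run : ∀ b n → breaks (positive (run true b n)) ≡ 0
breaks-positive-run b zero          = refl
breaks-positive-run b (suc zero)    = refl
breaks-positive-run b (suc (suc n)) = cong₂ _+_
  (cong (λ t → if t then 0 else 1) (dec-true (suc b ≟ suc b) refl)) (breaks-positive-run (suc b) (suc n))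

private
  pieces₃ : ∀ a b c → breaks (a ++ b ++ c) ≤ 2 + (breaks a + (breaks b + breaks c))
  pieces₃ a b c = begin
    breaks (a ++ b ++ c)                         ≤⟨ breaks-++-≤ a (b ++ c) ⟩
    suc (breaks a + breaks (b ++ c))             ≤⟨ s≤s (+-monoʳ-≤ (breaks a) (breaks-++-≤ b c)) ⟩
    suc (breaks a + suc (breaks b + breaks c))   ≡⟨ cong suc (+-suc (breaks a) _) ⟩
    2 + (breaks a + (breaks b + breaks c)) ∎
    where open ≤-Reasoning

  pieces₄ : ∀ a b c d → breaks (a ++ b ++ c ++ d) ≤ 3 + (breaks a + (breaks b + (breaks c + breaks d)))
  pieces₄ a b c d = begin
    breaks (a ++ b ++ c ++ d)                                ≤⟨ breaks-++-≤ a (b ++ c ++ d) ⟩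
    suc (breaks a + breaks (b ++ c ++ d))                    ≤⟨ s≤s (+-monoʳ-≤ (breaks a) (pieces₃ b c d)) ⟩
    suc (breaks a + (2 + (breaks b + (breaks c + breaks d)))) ≡⟨ cong suc (trans (+-suc (breaks a) _) (cong suc (+-suc (breaks a) _))) ⟩
    3 + (breaks a + (breaks b + (breaks c + breaks d))) ∎
    where open ≤-Reasoning

  pieces₅ : ∀ a b c d e → breaks (a ++ b ++ c ++ d ++ e) ≤ 4 + (breaks a + (breaks b + (breaks c + (breaks d + breaks e))))
  pieces₅ a b c d e = begin
    breaks (a ++ b ++ c ++ d ++ e)                           ≤⟨ breaks-++-≤ a (b ++ c ++ d ++ e) ⟩
    suc (breaks a + breaks (b ++ c ++ d ++ e))               ≤⟨ s≤s (+-monoʳ-≤ (breaks a) (pieces₄ b c d e)) ⟩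
    suc (breaks a + (3 + (breaks b + (breaks c + (breaks d + breaks e))))) ≡⟨ cong suc (trans (+-suc (breaks a) _) (cong suc (trans (+-suc (breaks a) _) (cong suc (+-suc (breaks a) _))))) ⟩
    4 + (breaks a + (breaks b + (breaks c + (breaks d + breaks e)))) ∎
    where open ≤-Reasoning

  pieces₃′ : ∀ a b c → breaks a + (breaks b + breaks c) ≤ breaks (a ++ b ++ c)
  pieces₃′ a b c = ≤-trans (+-monoʳ-≤ (breaks a) (breaks-+-≤ b c)) (breaks-+-≤ a (b ++ c))

  pieces₄′ : ∀ a b c d → breaks a + (breaks b + (breaks c + breaks d)) ≤ breaks (a ++ b ++ c ++ d)
  pieces₄′ a b c d = ≤-trans (+-monoʳ-≤ (breaks a) (pieces₃′ b c d)) (breaks-+-≤ a (b ++ c ++ d))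

  pieces₅′ : ∀ a b c d e → breaks a + (breaks b + (breaks c + (breaks d + breaks e))) ≤ breaks (a ++ b ++ c ++ d ++ e)
  pieces₅′ a b c d e = ≤-trans (+-monoʳ-≤ (breaks a) (pieces₄′ b c d e)) (breaks-+-≤ a (b ++ c ++ d ++ e))

breaks-reverse-block : ∀ a b c → breaks (a ++ reverseFlip b ++ c) ≤ 4 + breaks (a ++ b ++ c)
breaks-reverse-block a b c = begin
  breaks (a ++ reverseFlip b ++ c)                         ≤⟨ pieces₃ a (reverseFlip b) c ⟩
  2 + (breaks a + (breaks (reverseFlip b) + breaks c))     ≡⟨ cong (λ m → 2 + (breaks a + (m + breaks c))) (breaks-reverseFlip b) ⟩
  2 + (breaks a + (breaks b + breaks c))                   ≤⟨ +-mono-≤ {2} {4} (s≤s (s≤s z≤n)) (pieces₃′ a b c) ⟩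
  4 + breaks (a ++ b ++ c) ∎
  where open ≤-Reasoning

breaks-exchange : ∀ a b c d → breaks (a ++ c ++ b ++ d) ≤ 3 + (breaks a + (breaks b + (breaks c + breaks d)))
breaks-exchange a b c d = ≤-trans (pieces₄ a c b d)
  (≤-reflexive (solve 4 (λ a b c d → con 3 :+ (a :+ (c :+ (b :+ d))) := con 3 :+ (a :+ (b :+ (c :+ d)))) refl (breaks a) (breaks b) (breaks c) (breaks d)))
  where open +-*-Solver

breaks-swap : ∀ a b c d → breaks (a ++ c ++ b ++ d) ≤ 4 + breaks (a ++ b ++ c ++ d)
breaks-swap a b c d = ≤-trans (breaks-exchange a b c d) (+-mono-≤ {3} {4} (n≤1+n 3) (pieces₄′ a b c d))

breaks-swap-reverseʳ : ∀ a b c d → breaks (a ++ c ++ reverseFlip b ++ d) ≤ 4 + breaks (a ++ b ++ c ++ d)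
breaks-swap-reverseʳ a b c d = begin
  breaks (a ++ c ++ reverseFlip b ++ d)                                ≤⟨ breaks-exchange a (reverseFlip b) c d ⟩
  3 + (breaks a + (breaks (reverseFlip b) + (breaks c + breaks d)))    ≡⟨ cong (λ m → 3 + (breaks a + (m + (breaks c + breaks d)))) (breaks-reverseFlip b) ⟩
  3 + (breaks a + (breaks b + (breaks c + breaks d)))                  ≤⟨ +-mono-≤ {3} {4} (n≤1+n 3) (pieces₄′ a b c d) ⟩
  4 + breaks (a ++ b ++ c ++ d) ∎
  where open ≤-Reasoning

breaks-swap-reverseˡ : ∀ a b c d → breaks (a ++ reverseFlip c ++ b ++ d) ≤ 4 + breaks (a ++ b ++ c ++ d)
breaks-swap-reverseˡ a b c d = begin
  breaks (a ++ reverseFlip c ++ b ++ d)                                ≤⟨ breaks-exchange a b (reverseFlip c) d ⟩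
  3 + (breaks a + (breaks b + (breaks (reverseFlip c) + breaks d)))    ≡⟨ cong (λ m → 3 + (breaks a + (breaks b + (m + breaks d)))) (breaks-reverseFlip c) ⟩
  3 + (breaks a + (breaks b + (breaks c + breaks d)))                  ≤⟨ +-mono-≤ {3} {4} (n≤1+n 3) (pieces₄′ a b c d) ⟩
  4 + breaks (a ++ b ++ c ++ d) ∎
  where open ≤-Reasoning

-- The case that dictates the constant 4. The other operations involve two or three joints and are
-- weakened to the same bound so that all six can be treated alike.
breaks-interchange : ∀ a b c d e → breaks (a ++ d ++ c ++ b ++ e) ≤ 4 + breaks (a ++ b ++ c ++ d ++ e)
breaks-interchange a b c d e = begin
  breaks (a ++ d ++ c ++ b ++ e)                                            ≤⟨ pieces₅ a d c b e ⟩
  4 + (breaks a + (breaks d + (breaks c + (breaks b + breaks e))))          ≡⟨ solve 5 (λ a b c d e → con 4 :+ (a :+ (d :+ (c :+ (b :+ e)))) := con 4 :+ (a :+ (b :+ (c :+ (d :+ e))))) refl (breaks a) (breaks b) (breaks c) (breaks d) (breaks e) ⟩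
  4 + (breaks a + (breaks b + (breaks c + (breaks d + breaks e))))          ≤⟨ +-monoʳ-≤ 4 (pieces₅′ a b c d e) ⟩
  4 + breaks (a ++ b ++ c ++ d ++ e) ∎
  where open ≤-Reasoning; open +-*-Solver

-- Lifting sorting sequences to signed values

module _ {A B : Set} (f : A → B) where

  map-++⁻ : ∀ xs ys {zs} → map f xs ≡ ys ++ zs →
    ∃[ us ] ∃[ vs ] (xs ≡ us ++ vs × map f us ≡ ys × map f vs ≡ zs)
  map-++⁻ xs       []       eq = [] , xs , refl , refl , eq
  map-++⁻ (x ∷ xs) (y ∷ ys) eq with refl , eq′ ← ∷-injective eq
                               with us , vs , refl , refl , refl ← map-++⁻ xs ys eq′ = x ∷ us , vs , refl , refl , refl

  map-++₃⁻ : ∀ xs as bs {cs} → map f xs ≡ as ++ bs ++ cs →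
    ∃[ us ] ∃[ vs ] ∃[ ws ] (xs ≡ us ++ vs ++ ws × map f us ≡ as × map f vs ≡ bs × map f ws ≡ cs)
  map-++₃⁻ xs as bs eq with us , r , refl , refl , eq₁ ← map-++⁻ xs as eq
                       with vs , ws , refl , refl , refl ← map-++⁻ r bs eq₁ = us , vs , ws , refl , refl , refl , refl

  map-++₄⁻ : ∀ xs as bs cs {ds} → map f xs ≡ as ++ bs ++ cs ++ ds →
    ∃[ us ] ∃[ vs ] ∃[ ws ] ∃[ ts ] (xs ≡ us ++ vs ++ ws ++ ts × map f us ≡ as × map f vs ≡ bs × map f ws ≡ cs × map f ts ≡ ds)
  map-++₄⁻ xs as bs cs eq with us , r , refl , refl , eq₁ ← map-++⁻ xs as eq
                          with vs , ws , ts , refl , refl , refl , refl ← map-++₃⁻ r bs cs eq₁ = us , vs , ws , ts , refl , refl , refl , refl , refl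

  map-++₅⁻ : ∀ xs as bs cs ds {es} → map f xs ≡ as ++ bs ++ cs ++ ds ++ es →
    ∃[ us ] ∃[ vs ] ∃[ ws ] ∃[ ts ] ∃[ ss ] (xs ≡ us ++ vs ++ ws ++ ts ++ ss × map f us ≡ as × map f vs ≡ bs × map f ws ≡ cs × map f ts ≡ ds × map f ss ≡ es)
  map-++₅⁻ xs as bs cs ds eq with us , r , refl , refl , eq₁ ← map-++⁻ xs as eq
                             with vs , ws , ts , ss , refl , refl , refl , refl , refl ← map-++₄⁻ r bs cs ds eq₁ = us , vs , ws , ts , ss , refl , refl , refl , refl , refl , refl

-- Signs travel against the step, from its target to its source. The weights are quantified last,
-- because they are chosen only after the signed source and its breaks are known.
record StepLift (op : Op) (π : List ℕ) (ρ̂ : List SignedValue) : Set where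
  constructor lift
  field
    source  : List SignedValue
    over    : values source ≡ π
    breaks≤ : breaks source ≤ 4 + breaks ρ̂
    blown   : ∀ w → Step op (blowUp w source) (blowUp w ρ̂)

private
  values₃ : ∀ a b c → values (a ++ b ++ c) ≡ values a ++ values b ++ values c
  values₃ a b c = trans (map-++ proj₂ a (b ++ c)) (cong (values a ++_) (map-++ proj₂ b c))

  values₄ : ∀ a b c d → values (a ++ b ++ c ++ d) ≡ values a ++ values b ++ values c ++ values d
  values₄ a b c d = trans (map-++ proj₂ a (b ++ c ++ d)) (cong (values a ++_) (values₃ b c d))

  values₅ : ∀ a b c d e → values (a ++ b ++ c ++ d ++ e) ≡ values a ++ values b ++ values c ++ values d ++ values e
  values₅ a b c d e = trans (map-++ proj₂ a (b ++ c ++ d ++ e)) (cong (values a ++_) (values₄ b c d e))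

  unreverse : ∀ b b̂ → values b̂ ≡ reverse b → values (reverseFlip b̂) ≡ b
  unreverse b b̂ eq = trans (values-reverseFlip b̂) (trans (cong reverse eq) (reverse-involutive b))

  reblow : ∀ w b → reverse (blowUp w (reverseFlip b)) ≡ blowUp w b
  reblow w b = trans (cong reverse (blowUp-reverseFlip w b)) (reverse-involutive _)

  reverse-lift : ∀ {op} → (∀ a b c → Step op (a ++ b ++ c) (a ++ reverse b ++ c)) →
    ∀ a b c ρ̂ → values ρ̂ ≡ a ++ reverse b ++ c → StepLift op (a ++ b ++ c) ρ̂
  reverse-lift {op} s a b c ρ̂ eq with a , b̂ , c , refl , refl , eqb , refl ← map-++₃⁻ proj₂ ρ̂ a (reverse b) eq = lift
    (a ++ reverseFlip b̂ ++ c)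
    (trans (values₃ a (reverseFlip b̂) c) (cong (λ b → values a ++ b ++ values c) (unreverse b b̂ eqb)))
    (breaks-reverse-block a b̂ c)
    λ w → subst₂ (Step op) (sym (blowUp-++₃ w a (reverseFlip b̂) c))
      (trans (cong (λ b → blowUp w a ++ b ++ blowUp w c) (reblow w b̂)) (sym (blowUp-++₃ w a b̂ c)))
      (s (blowUp w a) (blowUp w (reverseFlip b̂)) (blowUp w c))

  swap-lift : ∀ {op} → (∀ a b c d → Step op (a ++ b ++ c ++ d) (a ++ c ++ b ++ d)) →
    ∀ a b c d ρ̂ → values ρ̂ ≡ a ++ c ++ b ++ d → StepLift op (a ++ b ++ c ++ d) ρ̂
  swap-lift {op} s a b c d ρ̂ eq with a , c , b , d , refl , refl , refl , refl , refl ← map-++₄⁻ proj₂ ρ̂ a c b eq = lift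
    (a ++ b ++ c ++ d)
    (values₄ a b c d)
    (breaks-swap a c b d)
    λ w → subst₂ (Step op) (sym (blowUp-++₄ w a b c d)) (sym (blowUp-++₄ w a c b d))
      (s (blowUp w a) (blowUp w b) (blowUp w c) (blowUp w d))

stepLift : ∀ {op π ρ} → Step op π ρ → ∀ ρ̂ → values ρ̂ ≡ ρ → StepLift op π ρ̂
stepLift (brev a b c)   = reverse-lift brev a b c
stepLift (btr a b c d)  = swap-lift btr a b c d
stepLift (bint a b c d e) ρ̂ eq
  with a , d , c , b , e , refl , refl , refl , refl , refl , refl ← map-++₅⁻ proj₂ ρ̂ a d c b eq = lift
    (a ++ b ++ c ++ d ++ e)
    (values₅ a b c d e)
    (breaks-interchange a d c b e)
    λ w → subst₂ (Step blockInterchange) (sym (blowUp-++₅ w a b c d e)) (sym (blowUp-++₅ w a d c b e))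
      (bint (blowUp w a) (blowUp w b) (blowUp w c) (blowUp w d) (blowUp w e))
stepLift (ptr b c d) ρ̂ eq
  with c , b , d , refl , refl , refl , refl ← map-++₃⁻ proj₂ ρ̂ c b eq = lift
    (b ++ c ++ d)
    (values₃ b c d)
    (breaks-swap [] c b d)
    λ w → subst₂ (Step prefixTransposition) (sym (blowUp-++₃ w b c d)) (sym (blowUp-++₃ w c b d))
      (ptr (blowUp w b) (blowUp w c) (blowUp w d))
stepLift (prev b c) ρ̂ eq
  with b̂ , c , refl , eqb , refl ← map-++⁻ proj₂ ρ̂ (reverse b) eq = lift
    (reverseFlip b̂ ++ c)
    (trans (map-++ proj₂ (reverseFlip b̂) c) (cong (_++ values c) (unreverse b b̂ eqb)))
    (breaks-reverse-block [] b̂ c)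
    λ w → subst₂ (Step prefixReversal) (sym (blowUp-++ w (reverseFlip b̂) c))
      (trans (cong (_++ blowUp w c) (reblow w b̂)) (sym (blowUp-++ w b̂ c)))
      (prev (blowUp w (reverseFlip b̂)) (blowUp w c))
stepLift (cpR a b c d)  = swap-lift cpR a b c d
stepLift (cpL a b c d)  = swap-lift (λ a b c d → cpL a c b d) a c b d
stepLift (cpRr a b c d) ρ̂ eq
  with a , c , b̂ , d , refl , refl , refl , eqb , refl ← map-++₄⁻ proj₂ ρ̂ a c (reverse b) eq = lift
    (a ++ reverseFlip b̂ ++ c ++ d)
    (trans (values₄ a (reverseFlip b̂) c d) (cong (λ b → values a ++ b ++ values c ++ values d) (unreverse b b̂ eqb)))
    (breaks-swap-reverseˡ a c b̂ d)
    λ w → subst₂ (Step cutPaste) (sym (blowUp-++₄ w a (reverseFlip b̂) c d))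
      (trans (cong (λ b → blowUp w a ++ blowUp w c ++ b ++ blowUp w d) (reblow w b̂)) (sym (blowUp-++₄ w a c b̂ d)))
      (cpRr (blowUp w a) (blowUp w (reverseFlip b̂)) (blowUp w c) (blowUp w d))
stepLift (cpLr a b c d) ρ̂ eq
  with a , b̂ , c , d , refl , refl , eqb , refl , refl ← map-++₄⁻ proj₂ ρ̂ a (reverse b) c eq = lift
    (a ++ c ++ reverseFlip b̂ ++ d)
    (trans (values₄ a c (reverseFlip b̂) d) (cong (λ b → values a ++ values c ++ b ++ values d) (unreverse b b̂ eqb)))
    (breaks-swap-reverseʳ a b̂ c d)
    λ w → subst₂ (Step cutPaste) (sym (blowUp-++₄ w a c (reverseFlip b̂) d))
      (trans (cong (λ b → blowUp w a ++ b ++ blowUp w c ++ blowUp w d) (reblow w b̂)) (sym (blowUp-++₄ w a b̂ c d)))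
      (cpLr (blowUp w a) (blowUp w (reverseFlip b̂)) (blowUp w c) (blowUp w d))

record SortLift (op : Op) (k : ℕ) (π : List ℕ) (n : ℕ) : Set where
  constructor lift
  field
    source  : List SignedValue
    over    : values source ≡ π
    breaks≤ : breaks source ≤ k * 4
    blown   : ∀ w → Within op k (blowUp w source) (upTo (sumTo w n))

sortLift : ∀ {op k π n} → Within op k π (upTo n) → SortLift op k π n
sortLift {op} {n = n} within = go within refl
  where
    go : ∀ {k π σ} → Within op k π σ → σ ≡ upTo n → SortLift op k π n
    -- Positive signs on the identity give no breaks at all; the steps left over in `k` only loosen
    -- the bound.
    go {k} done refl = lift (positive (upTo n)) (values-positive (upTo n))
      (subst (_≤ k * 4) (sym (trans (cong (breaks ∘ positive) (upTo≡run n)) (breaks-positive-run 0 n))) z≤n)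
      λ w → subst (λ π → Within op k π (upTo (sumTo w n))) (sym (blowUp-upTo w n)) done
    go (step s within) eq with lift ρ̂ over b≤ blown ← go within eq
                          with lift π̂ over′ b≤′ blown′ ← stepLift s ρ̂ over =
      lift π̂ over′ (≤-trans b≤′ (+-monoʳ-≤ 4 b≤)) λ w → step (blown′ w) (blown w)

private
  reverse-↭ : ∀ (a b c : List ℕ) → a ++ b ++ c ↭ a ++ reverse b ++ c
  reverse-↭ a b c = Perm.++⁺ˡ a (Perm.++⁺ʳ c (↭-sym (Perm.↭-reverse b)))

  swap-↭ : ∀ (a b c d : List ℕ) → a ++ b ++ c ++ d ↭ a ++ c ++ b ++ d
  swap-↭ a b c d = Perm.++⁺ˡ a (subst₂ _↭_ (++-assoc b c d) (++-assoc c b d) (Perm.++⁺ʳ d (Perm.++-comm b c)))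

step-↭ : ∀ {op π ρ} → Step op π ρ → π ↭ ρ
step-↭ (brev a b c)     = reverse-↭ a b c
step-↭ (btr a b c d)    = swap-↭ a b c d
step-↭ (bint a b c d e) = Perm.++⁺ˡ a (↭-trans (swap-↭ b c d e)
  (subst (_↭ d ++ c ++ b ++ e) (swap-assoc b d c e) (↭-trans (swap-↭ [] b (d ++ c) e) (subst (_↭ d ++ c ++ b ++ e) (sym (++-assoc d c (b ++ e))) ↭-refl))))
  where
    swap-assoc : ∀ (b d c e : List ℕ) → b ++ (d ++ c) ++ e ≡ b ++ d ++ c ++ e
    swap-assoc b d c e = cong (b ++_) (++-assoc d c e)
step-↭ (ptr b c d)      = swap-↭ [] b c d
step-↭ (prev b c)       = reverse-↭ [] b c
step-↭ (cpR a b c d)    = swap-↭ a b c d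
step-↭ (cpRr a b c d)   = ↭-trans (reverse-↭ a b (c ++ d)) (swap-↭ a (reverse b) c d)
step-↭ (cpL a b c d)    = swap-↭ a c b d
step-↭ (cpLr a b c d)   = ↭-trans (swap-↭ a c b d) (reverse-↭ a b (c ++ d))

within-↭ : ∀ {op k π ρ} → Within op k π ρ → π ↭ ρ
within-↭ done       = ↭-refl
within-↭ (step s w) = ↭-trans (step-↭ s) (within-↭ w)

-- Ranks and patterns

-- A comparison with values 0 and 1, so that ranks become sums and can be handled by arithmetic.
lt : ℕ → ℕ → ℕ
lt x       zero    = 0
lt zero    (suc y) = 1
lt (suc x) (suc y) = lt x y

<⇒lt : ∀ {x y} → x < y → lt x y ≡ 1
<⇒lt z<s             = refl
<⇒lt {suc _} (s<s x<y) = <⇒lt x<y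

≥⇒lt : ∀ {x y} → y ≤ x → lt x y ≡ 0
≥⇒lt z≤n       = refl
≥⇒lt (s≤s y≤x) = ≥⇒lt y≤x

lt-cong : ∀ {x y x′ y′} → (x < y → x′ < y′) → (x′ < y′ → x < y) → lt x y ≡ lt x′ y′
lt-cong {x} {y} f g with <-≤-connex x y
... | inj₁ x<y = trans (<⇒lt x<y) (sym (<⇒lt (f x<y)))
... | inj₂ y≤x = trans (≥⇒lt y≤x) (sym (≥⇒lt (≮⇒≥ (λ lt → ≤⇒≯ y≤x (g lt)))))

lt-mono : ∀ x {y y′} → y ≤ y′ → lt x y ≤ lt x y′
lt-mono x {y} {y′} y≤y′ with <-≤-connex x y
... | inj₁ x<y = ≤-reflexive (trans (<⇒lt x<y) (sym (<⇒lt (<-≤-trans x<y y≤y′))))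
... | inj₂ y≤x = subst (_≤ lt x y′) (sym (≥⇒lt y≤x)) z≤n

countBelow : ℕ → List ℕ → ℕ
countBelow l []       = 0
countBelow l (x ∷ xs) = lt x l + countBelow l xs

countBelow-++ : ∀ l xs ys → countBelow l (xs ++ ys) ≡ countBelow l xs + countBelow l ys
countBelow-++ l []       ys = refl
countBelow-++ l (x ∷ xs) ys = trans (cong (lt x l +_) (countBelow-++ l xs ys)) (sym (+-assoc (lt x l) _ _))

countBelow-↭ : ∀ l {xs ys} → xs ↭ ys → countBelow l xs ≡ countBelow l ys
countBelow-↭ l _↭_.refl          = refl
countBelow-↭ l (prep x p)        = cong (lt x l +_) (countBelow-↭ l p)
countBelow-↭ l (swap x y p)      = trans (cong (λ m → lt x l + (lt y l + m)) (countBelow-↭ l p))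
  (solve 3 (λ a b c → a :+ (b :+ c) := b :+ (a :+ c)) refl (lt x l) (lt y l) _)
  where open +-*-Solver
countBelow-↭ l (_↭_.trans p q)   = trans (countBelow-↭ l p) (countBelow-↭ l q)

countBelow-all : ∀ l {xs} → All (_< l) xs → countBelow l xs ≡ length xs
countBelow-all l []         = refl
countBelow-all l (x< ∷ xs<) = cong₂ _+_ (<⇒lt x<) (countBelow-all l xs<)

countBelow-none : ∀ l {xs} → All (l ≤_) xs → countBelow l xs ≡ 0
countBelow-none l []         = refl
countBelow-none l (≤x ∷ ≤xs) = cong₂ _+_ (≥⇒lt ≤x) (countBelow-none l ≤xs)

∈-run⁺ : ∀ σ {b x} n → b ≤ x → x < b + n → x ∈ run σ b n
∈-run⁺ σ     {b} {x} zero    b≤x x< = contradiction (subst (x <_) (+-identityʳ b) x<) (≤⇒≯ b≤x)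
∈-run⁺ true  {b} {x} (suc n) b≤x x< with m≤n⇒m<n∨m≡n b≤x
... | inj₁ b<x  = there (∈-run⁺ true n b<x (subst (x <_) (+-suc b n) x<))
... | inj₂ refl = here refl
∈-run⁺ false {b} {x} (suc n) b≤x x< with m≤n⇒m<n∨m≡n (≤-pred (subst (x <_) (+-suc b n) x<))
... | inj₁ x<b+n = there (∈-run⁺ false n b≤x x<b+n)
... | inj₂ refl  = here refl

run-bounds : ∀ σ b n → All (λ x → b ≤ x × x < b + n) (run σ b n)
run-bounds true  b zero    = []
run-bounds true  b (suc n) = (≤-refl , m<m+n b z<s) ∷
  All.map (λ {x} (b<x , x<) → <⇒≤ b<x , subst (x <_) (sym (+-suc b n)) x<) (run-bounds true (suc b) n)
run-bounds false b zero    = []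
run-bounds false b (suc n) = (m≤m+n b n , +-monoʳ-< b (n<1+n n)) ∷
  All.map (λ (b≤x , x<) → b≤x , <-trans x< (+-monoʳ-< b (n<1+n n))) (run-bounds false b n)

countBelow-run-above : ∀ {l} σ b n → b + n ≤ l → countBelow l (run σ b n) ≡ n
countBelow-run-above σ b n h = trans
  (countBelow-all _ (All.map (λ (_ , x<) → <-≤-trans x< h) (run-bounds σ b n))) (length-run σ b n)

countBelow-run-below : ∀ {l} σ b n → l ≤ b → countBelow l (run σ b n) ≡ 0
countBelow-run-below σ b n h = countBelow-none _ (All.map (λ (b≤x , _) → ≤-trans h b≤x) (run-bounds σ b n))

countBelow-upTo : ∀ {l n} → l ≤ n → countBelow l (upTo n) ≡ l
countBelow-upTo {l} {n} l≤n with k , refl ← m≤n⇒∃[o]m+o≡n l≤n = begin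
  countBelow l (upTo (l + k))                                ≡⟨ cong (countBelow l) (trans (upTo≡run (l + k)) (run-true-++ 0 l k)) ⟩
  countBelow l (run true 0 l ++ run true l k)                ≡⟨ countBelow-++ l (run true 0 l) _ ⟩
  countBelow l (run true 0 l) + countBelow l (run true l k)  ≡⟨ cong₂ _+_ (countBelow-run-above true 0 l ≤-refl) (countBelow-run-below true l k ≤-refl) ⟩
  l + 0                                                      ≡⟨ +-identityʳ l ⟩
  l ∎
  where open ≡-Reasoning

perm-unique : ∀ {π} → Perm π → Unique π
perm-unique {π} p = PermSetoid.Unique-resp-↭ (setoid ℕ) (↭⇒↭ₛ (↭-sym p)) (Unique.upTo⁺ (length π))

perm-bounds : ∀ {π} → Perm π → All (_< length π) π
perm-bounds {π} p = Perm.All-resp-↭ (↭-sym p)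
  (subst (All (_< length π)) (sym (upTo≡run (length π))) (All.map proj₂ (run-bounds true 0 (length π))))

-- Each value of a permutation is its own rank, so a permutation can be recovered from the ranks in
-- any sequence order-isomorphic to it.
countBelow-perm : ∀ {π} → Perm π → All (λ x → countBelow x π ≡ x) π
countBelow-perm p = All.map (λ x< → trans (countBelow-↭ _ p) (countBelow-upTo (<⇒≤ x<))) (perm-bounds p)

δ : ℕ → ℕ → ℕ
δ zero    zero    = 1
δ zero    (suc x) = 0
δ (suc a) zero    = 0
δ (suc a) (suc x) = δ a x

δ-refl : ∀ a → δ a a ≡ 1
δ-refl zero    = refl
δ-refl (suc a) = δ-refl a

δ-≢ : ∀ {a x} → a ≢ x → δ a x ≡ 0
δ-≢ {zero}  {zero}  ≢ = contradiction refl ≢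
δ-≢ {zero}  {suc x} ≢ = refl
δ-≢ {suc a} {zero}  ≢ = refl
δ-≢ {suc a} {suc x} ≢ = δ-≢ (≢ ∘ cong suc)

lt-suc : ∀ a x → lt a x + δ a x ≡ lt a (suc x)
lt-suc zero    zero    = refl
lt-suc zero    (suc x) = refl
lt-suc (suc a) zero    = refl
lt-suc (suc a) (suc x) = lt-suc a x

sumTo-δ : ∀ a n → sumTo (δ a) n ≡ lt a n
sumTo-δ a zero    = refl
sumTo-δ a (suc n) = trans (cong (_+ δ a n) (sumTo-δ a n)) (lt-suc a n)

mult : List ℕ → ℕ → ℕ
mult []       x = 0
mult (t ∷ ts) x = δ t x + mult ts x

mult-∉ : ∀ {x ts} → All (x ≢_) ts → mult ts x ≡ 0
mult-∉ []       = refl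
mult-∉ (≢ ∷ ≢s) = cong₂ _+_ (δ-≢ (≢ ∘ sym)) (mult-∉ ≢s)

-- In the blow-up with weights `mult ts`, the block of a value thus starts at the rank of that value
-- in `ts`.
sumTo-mult : ∀ ts n → sumTo (mult ts) n ≡ countBelow n ts
sumTo-mult []       zero    = refl
sumTo-mult []       (suc n) = trans (+-identityʳ _) (sumTo-mult [] n)
sumTo-mult (t ∷ ts) n       = trans (lem n) (cong₂ _+_ (sumTo-δ t n) (sumTo-mult ts n))
  where
    open +-*-Solver
    lem : ∀ n → sumTo (mult (t ∷ ts)) n ≡ sumTo (δ t) n + sumTo (mult ts) n
    lem zero    = refl
    lem (suc n) = trans (cong (_+ (δ t n + mult ts n)) (lem n))
      (solve 4 (λ a b c d → (a :+ b) :+ (c :+ d) := (a :+ c) :+ (b :+ d)) refl (sumTo (δ t) n) _ (δ t n) (mult ts n))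

-- Giving each element of τ ⊆ π multiplicity one and deleting the rest standardises τ.
blowUp-sublist : ∀ w {τ π} → τ ⊆ π → Unique π → All (λ x → w x ≡ mult τ x) π →
  ∀ π̂ → values π̂ ≡ π → blowUp w π̂ ≡ map (sumTo w) τ
blowUp-sublist w [] _ _ [] refl = refl
blowUp-sublist w (_∷ʳ_ y τ⊆) (y∉ ∷ u) (eq ∷ eqs) ((s , y) ∷ π̂) refl
  rewrite trans eq (mult-∉ (All-resp-⊆ τ⊆ y∉)) with s
... | true  = blowUp-sublist w τ⊆ u eqs π̂ refl
... | false = blowUp-sublist w τ⊆ u eqs π̂ refl
blowUp-sublist w {x ∷ τ} (refl ∷ τ⊆) (x∉ ∷ u) (eq ∷ eqs) ((s , x) ∷ π̂) refl
  rewrite trans eq (cong₂ _+_ (δ-refl x) (mult-∉ (All-resp-⊆ τ⊆ x∉)))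
  = cong₂ _++_ (run-short s true (sumTo w x) ≤-refl)
      (blowUp-sublist w τ⊆ u (All.zipWith (λ (≢ , eq) → trans eq (cong (_+ mult τ _) (δ-≢ ≢))) (x∉ , eqs)) π̂ refl)

ordIso-countBelow : ∀ {xs ys} → OrdIso xs ys →
  map (λ x → countBelow x xs) xs ≡ map (λ y → countBelow y ys) ys
ordIso-countBelow [] = refl
ordIso-countBelow {x ∷ xs} {y ∷ ys} (pw ∷ iso) = cong₂ _∷_
  (cong₂ _+_ (trans (≥⇒lt (≤-refl {x})) (sym (≥⇒lt (≤-refl {y})))) (heads pw))
  (tails pw (ordIso-countBelow iso))
  where
    Agree : ℕ → ℕ → Set
    Agree a b = ((x < a) ⇔ (y < b)) × ((a < x) ⇔ (b < y))
    heads : ∀ {as bs} → Pointwise Agree as bs → countBelow x as ≡ countBelow y bs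
    heads []                = refl
    heads ((_ , gt) ∷ pw)   = cong₂ _+_ (lt-cong (to gt) (from gt)) (heads pw)
    tails : ∀ {as bs} → Pointwise Agree as bs → ∀ {f g : ℕ → ℕ} → map f as ≡ map g bs →
            map (λ a → lt x a + f a) as ≡ map (λ b → lt y b + g b) bs
    tails []              _  = refl
    tails ((l , _) ∷ pw)  eq = let h , t = ∷-injective eq in
      cong₂ _∷_ (cong₂ _+_ (lt-cong (to l) (from l)) h) (tails pw t)

ordIso-length : ∀ {xs ys} → OrdIso xs ys → length xs ≡ length ys
ordIso-length []        = refl
ordIso-length (_ ∷ iso) = cong suc (ordIso-length iso)

-- The values outside `τ` are deleted from the entire sorting sequence. What is left of `π` is `τ`
-- with its entries replaced by their ranks, and an order isomorphism preserves ranks, so this is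
-- `σ`.
sortable-closed : ∀ {op k} π σ → Sortable op k π → Perm σ → σ ≼ π → Sortable op k σ
sortable-closed {op} {k} π σ (perm , within) permσ (τ , τ⊆π , iso)
  with lift π̂ over _ blown ← sortLift within = permσ , subst₂ (Within op k) blown≡σ (cong upTo size) (blown w)
  where
    open ≡-Reasoning
    w = mult τ
    blown≡σ : blowUp w π̂ ≡ σ
    blown≡σ = begin
      blowUp w π̂                      ≡⟨ blowUp-sublist w τ⊆π (perm-unique perm) (All.universal (λ _ → refl) π) π̂ over ⟩
      map (sumTo w) τ                 ≡⟨ map-cong (sumTo-mult τ) τ ⟩
      map (λ y → countBelow y τ) τ    ≡⟨ ordIso-countBelow iso ⟨
      map (λ x → countBelow x σ) σ    ≡⟨ map-id-local (countBelow-perm permσ) ⟩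
      σ ∎
    size : sumTo w (length π) ≡ length σ
    size = begin
      sumTo w (length π)              ≡⟨ sumTo-mult τ (length π) ⟩
      countBelow (length π) τ         ≡⟨ countBelow-all (length π) (All-resp-⊆ τ⊆π (perm-bounds perm)) ⟩
      length τ                        ≡⟨ ordIso-length iso ⟨
      length σ ∎

-- Every operation rearranges entries, so a list that reaches some identity is itself a permutation,
-- of the same length.
within⇒perm : ∀ {op k π m} → Within op k π (upTo m) → Perm π
within⇒perm {π = π} {m} within = subst (λ m → π ↭ upTo m) (sym (trans (Perm.↭-length (within-↭ within)) (length-upTo m))) (within-↭ within)

-- Decomposition into maximal monotone runs

-- ((l , σ) , e) stands for a monotone run of suc e consecutive values, increasing
-- iff σ is true.  In an absolute code l is the smallest value of the run; in a
-- relative code it is the rank of the run among the runs ordered by value.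
Item Code : Set
Item = (ℕ × Bool) × ℕ
Code = Word (ℕ × Bool)

label : Item → ℕ
label ((l , _) , _) = l

labels : Code → List ℕ
labels = map label

expand : Code → List ℕ
expand []                  = []
expand (((b , σ) , e) ∷ c) = run σ b (suc e) ++ expand c

relabelItem : (ℕ → ℕ) → Item → Item
relabelItem r ((l , σ) , e) = (r l , σ) , e

relabel : (ℕ → ℕ) → Code → Code
relabel r = map (relabelItem r)

-- With weights `one` this is the rank of a run, with weights `suc` the number of values in the runs
-- below it. The two choices translate absolute labels into relative ones and back.
below : (ℕ → ℕ) → Code → ℕ → ℕ
below w []                  l = 0
below w (((l′ , _) , e) ∷ c) l = lt l′ l * w e + below w c l

one : ℕ → ℕ
one _ = 1

inflate : Code → List ℕ
inflate c = expand (relabel (below suc c) c)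

-- Lists are parsed from the right, so a new value meets the front of the first run. A single value,
-- though stored as increasing, can still be extended in either direction; a longer run only in its
-- own.
glue : ℕ → Code → Code
glue x [] = ((x , true) , 0) ∷ []
glue x (((b , true) , zero) ∷ c) with suc x ≟ b | x ≟ suc b
... | yes _ | _     = ((x , true) , 1) ∷ c
... | no  _ | yes _ = ((b , false) , 1) ∷ c
... | no  _ | no  _ = ((x , true) , 0) ∷ ((b , true) , zero) ∷ c
glue x (((b , true) , suc e) ∷ c) with suc x ≟ b
... | yes _ = ((x , true) , 2 + e) ∷ c
... | no  _ = ((x , true) , 0) ∷ ((b , true) , suc e) ∷ c
glue x (((b , false) , e) ∷ c) with x ≟ suc (b + e)
... | yes _ = ((b , false) , suc e) ∷ c
... | no  _ = ((x , true) , 0) ∷ ((b , false) , e) ∷ c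

parse : List ℕ → Code
parse = foldr glue []

decompose : List ℕ → Code
decompose π = relabel (below one (parse π)) (parse π)

final : Item → ℕ
final ((b , true)  , e) = b + e
final ((b , false) , e) = b

Up Down : Item → Set
Up   ((_ , σ) , e) = σ ≡ true ⊎ e ≡ 0
Down ((_ , σ) , e) = σ ≡ false ⊎ e ≡ 0

Merges : ℕ → Item → Set
Merges x g@((b , _) , e) = (suc x ≡ b × Up g) ⊎ (x ≡ suc (b + e) × Down g)

-- Maximality of runs as the parser sees it: `h` is complete by the time the last value of `g` is
-- prepended.
Separated : Item → Item → Set
Separated g h = ¬ Merges (final g) h

-- A run of length one has both directions; it is stored as increasing.
Normal : Item → Set
Normal ((_ , σ) , e) = e ≡ 0 → σ ≡ true

separated-head : ∀ {g g′ c} → final g ≡ final g′ → Linked Separated (g ∷ c) → Linked Separated (g′ ∷ c)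
separated-head eq [-]      = [-]
separated-head eq (s ∷ ss) = subst (λ x → ¬ Merges x _) eq s ∷ ss

glue-normal : ∀ x {c} → All Normal c → All Normal (glue x c)
glue-normal x {[]} n = (λ _ → refl) ∷ []
glue-normal x {((b , true) , zero) ∷ c} (_ ∷ n) with suc x ≟ b | x ≟ suc b
... | yes _ | _     = (λ ()) ∷ n
... | no  _ | yes _ = (λ ()) ∷ n
... | no  _ | no  _ = (λ _ → refl) ∷ (λ _ → refl) ∷ n
glue-normal x {((b , true) , suc e) ∷ c} (_ ∷ n) with suc x ≟ b
... | yes _ = (λ ()) ∷ n
... | no  _ = (λ _ → refl) ∷ (λ ()) ∷ n
glue-normal x {((b , false) , e) ∷ c} (m ∷ n) with x ≟ suc (b + e)
... | yes _ = (λ ()) ∷ n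
... | no  _ = (λ _ → refl) ∷ m ∷ n

-- A glued value lengthens the first run at its front and leaves its last value alone, which is all
-- that separation from the next run depends on. If nothing is glued, the failed tests rule out both
-- ways of merging.
glue-separated : ∀ x {c} → All Normal c → Linked Separated c → Linked Separated (glue x c)
glue-separated x {[]} n l = [-]
glue-separated x {((b , true) , zero) ∷ c} n l with suc x ≟ b | x ≟ suc b
... | yes refl | _     = separated-head (trans (+-identityʳ (suc x)) (+-comm 1 x)) l
... | no  _ | yes _ = separated-head (+-identityʳ b) l
... | no ≢₁ | no ≢₂ = (λ { (inj₁ (eq , _)) → ≢₁ (trans (cong suc (sym (+-identityʳ x))) eq)
                         ; (inj₂ (eq , _)) → ≢₂ (trans (sym (+-identityʳ x)) (trans eq (cong suc (+-identityʳ b)))) }) ∷ l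
glue-separated x {((b , true) , suc e) ∷ c} n l with suc x ≟ b
... | yes refl = separated-head (sym (+-suc x (suc e))) l
... | no ≢     = (λ { (inj₁ (eq , _)) → ≢ (trans (cong suc (sym (+-identityʳ x))) eq)
                    ; (inj₂ (_ , inj₁ ())) ; (inj₂ (_ , inj₂ ())) }) ∷ l
glue-separated x {((b , false) , zero) ∷ c} (n ∷ _) l with () ← n refl
glue-separated x {((b , false) , suc e) ∷ c} n l with x ≟ suc (b + suc e)
... | yes _ = separated-head refl l
... | no ≢  = (λ { (inj₁ (_ , inj₁ ())) ; (inj₁ (_ , inj₂ ()))
                 ; (inj₂ (eq , _)) → ≢ (trans (sym (+-identityʳ x)) eq) }) ∷ l

parse-normal : ∀ π → All Normal (parse π)
parse-normal []      = []
parse-normal (x ∷ π) = glue-normal x (parse-normal π)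

parse-separated : ∀ π → Linked Separated (parse π)
parse-separated []      = []
parse-separated (x ∷ π) = glue-separated x (parse-normal π) (parse-separated π)

expand-glue : ∀ x c → expand (glue x c) ≡ x ∷ expand c
expand-glue x [] = refl
expand-glue x (((b , true) , zero) ∷ c) with suc x ≟ b | x ≟ suc b
... | yes refl | _     = refl
... | no  _ | yes refl = cong₂ (λ m n → m ∷ n ∷ expand c) (+-comm b 1) (+-identityʳ b)
... | no  _ | no  _    = refl
expand-glue x (((b , true) , suc e) ∷ c) with suc x ≟ b
... | yes refl = refl
... | no  _    = refl
expand-glue x (((b , false) , e) ∷ c) with x ≟ suc (b + e)
... | yes refl = cong (_∷ run false b (suc e) ++ expand c) (+-suc b e)
... | no  _    = refl

expand-parse : ∀ π → expand (parse π) ≡ π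
expand-parse []      = refl
expand-parse (x ∷ π) = trans (expand-glue x (parse π)) (cong (x ∷_) (expand-parse π))

glue-apart : ∀ x h c → ¬ Merges x h → glue x (h ∷ c) ≡ ((x , true) , 0) ∷ h ∷ c
glue-apart x ((b , true) , zero) c ¬m with suc x ≟ b | x ≟ suc b
... | yes eq | _     = contradiction (inj₁ (eq , inj₁ refl)) ¬m
... | no _ | yes eq  = contradiction (inj₂ (trans eq (cong suc (sym (+-identityʳ b))) , inj₂ refl)) ¬m
... | no _ | no _    = refl
glue-apart x ((b , true) , suc e) c ¬m with suc x ≟ b
... | yes eq = contradiction (inj₁ (eq , inj₁ refl)) ¬m
... | no  _  = refl
glue-apart x ((b , false) , e) c ¬m with x ≟ suc (b + e)
... | yes eq = contradiction (inj₂ (eq , inj₁ refl)) ¬m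
... | no  _  = refl

glue-up : ∀ b e c → glue b (((suc b , true) , e) ∷ c) ≡ ((b , true) , suc e) ∷ c
glue-up b zero    c with suc b ≟ suc b
... | yes _ = refl
... | no ≢  = contradiction refl ≢
glue-up b (suc e) c with suc b ≟ suc b
... | yes _ = refl
... | no ≢  = contradiction refl ≢

glue-single : ∀ b c → glue (suc b) (((b , true) , 0) ∷ c) ≡ ((b , false) , 1) ∷ c
glue-single b c with suc (suc b) ≟ b | suc b ≟ suc b
... | yes eq | _  = contradiction (sym eq) (<⇒≢ (m≤n⇒m≤1+n (n<1+n b)))
... | no _ | yes _ = refl
... | no _ | no ≢  = contradiction refl ≢

glue-down : ∀ b e c → glue (suc (b + e)) (((b , false) , e) ∷ c) ≡ ((b , false) , suc e) ∷ c
glue-down b e c with suc (b + e) ≟ suc (b + e)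
... | yes _ = refl
... | no ≢  = contradiction refl ≢

parse-run : ∀ σ b e {c} → Linked Separated (((b , σ) , e) ∷ c) → Normal ((b , σ) , e) →
  foldr glue c (run σ b (suc e)) ≡ ((b , σ) , e) ∷ c
parse-run true  b zero {[]}    l n = refl
parse-run true  b zero {h ∷ c} (s ∷ l) n = glue-apart b h c (s ∘ subst (λ x → Merges x h) (sym (+-identityʳ b)))
parse-run true  b (suc e)      l n = trans
  (cong (glue b) (parse-run true (suc b) e (separated-head (+-suc b e) l) (λ _ → refl)))
  (glue-up b e _)
parse-run false b zero         l n with () ← n refl
-- The last value of a decreasing run is first parsed as an increasing run of one value; the second
-- value read then settles the direction.
parse-run false b (suc zero) {c} l n = begin
  glue (b + 1) (foldr glue c (b + 0 ∷ []))  ≡⟨ cong₂ (λ x y → glue x (foldr glue c (y ∷ []))) (+-comm b 1) (+-identityʳ b) ⟩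
  glue (suc b) (foldr glue c (b ∷ []))      ≡⟨ cong (glue (suc b)) (parse-run true b 0 (separated-head (sym (+-identityʳ b)) l) (λ _ → refl)) ⟩
  glue (suc b) (((b , true) , 0) ∷ c)       ≡⟨ glue-single b c ⟩
  ((b , false) , 1) ∷ c ∎
  where open ≡-Reasoning
parse-run false b (suc (suc e)) {c} l n = begin
  glue (b + suc (suc e)) (foldr glue c (run false b (2 + e))) ≡⟨ cong₂ glue (+-suc b (suc e)) (parse-run false b (suc e) (separated-head refl l) (λ ())) ⟩
  glue (suc (b + suc e)) (((b , false) , suc e) ∷ c)          ≡⟨ glue-down b (suc e) c ⟩
  ((b , false) , 2 + e) ∷ c ∎
  where open ≡-Reasoning

parse-expand : ∀ {c} → Linked Separated c → All Normal c → parse (expand c) ≡ c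
parse-expand {[]} _ _ = refl
parse-expand {((b , σ) , e) ∷ c} l (n ∷ ns) = trans (foldr-++ glue [] (run σ b (suc e)) (expand c))
  (trans (cong (λ c → foldr glue c (run σ b (suc e))) (parse-expand (Linked.tail l) ns)) (parse-run σ b e l n))

-- Labels of runs and order-preserving relabelling

start-∈-run : ∀ σ b e → b ∈ run σ b (suc e)
start-∈-run σ b e = ∈-run⁺ σ (suc e) ≤-refl (m<m+n b z<s)

labels-⊆-expand : ∀ c {b} → b ∈ labels c → b ∈ expand c
labels-⊆-expand (((b , σ) , e) ∷ c) (here refl) = ∈-++⁺ˡ (start-∈-run σ b e)
labels-⊆-expand (((b , σ) , e) ∷ c) (there b∈)  = ∈-++⁺ʳ (run σ b (suc e)) (labels-⊆-expand c b∈)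

module _ {A : Set} where

  unique-++ʳ : ∀ (xs : List A) {ys} → Unique (xs ++ ys) → Unique ys
  unique-++ʳ []       u       = u
  unique-++ʳ (x ∷ xs) (_ ∷ u) = unique-++ʳ xs u

  unique-disjoint : ∀ (xs : List A) {ys x y} → Unique (xs ++ ys) → x ∈ xs → y ∈ ys → x ≢ y
  unique-disjoint (x ∷ xs) (x∉ ∷ u) (here refl) y∈ = All.lookup x∉ (∈-++⁺ʳ xs y∈)
  unique-disjoint (x ∷ xs) (x∉ ∷ u) (there x∈)  y∈ = unique-disjoint xs u x∈ y∈

labels-unique : ∀ c → Unique (expand c) → Unique (labels c)
labels-unique []                  u = []
labels-unique (((b , σ) , e) ∷ c) u =
  All.tabulate (λ l∈ → unique-disjoint (run σ b (suc e)) u (start-∈-run σ b e) (labels-⊆-expand c l∈))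
  ∷ labels-unique c (unique-++ʳ (run σ b (suc e)) u)

NotInside : ℕ → Item → Set
NotInside l ((b , _) , e) = l ≤ b ⊎ b + suc e ≤ l

∈-run-or-notInside : ∀ l σ b e → l ∈ run σ b (suc e) ⊎ NotInside l ((b , σ) , e)
∈-run-or-notInside l σ b e with ≤-<-connex l b | ≤-<-connex (b + suc e) l
... | inj₁ l≤b | _      = inj₂ (inj₁ l≤b)
... | inj₂ _ | inj₁ ≤l  = inj₂ (inj₂ ≤l)
... | inj₂ b<l | inj₂ l< = inj₁ (∈-run⁺ σ (suc e) (<⇒≤ b<l) l<)

∉-expand⇒notInside : ∀ {l} c → (∀ {x} → x ∈ expand c → l ≢ x) → All (NotInside l) c
∉-expand⇒notInside []                  ∉ = []
∉-expand⇒notInside {l} (((b , σ) , e) ∷ c) ∉ with ∈-run-or-notInside l σ b e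
... | inj₁ l∈ = contradiction refl (∉ (∈-++⁺ˡ l∈))
... | inj₂ ni = ni ∷ ∉-expand⇒notInside c (∉ ∘ ∈-++⁺ʳ (run σ b (suc e)))

label-notInside : ∀ c → Unique (expand c) → ∀ {l} → l ∈ labels c → All (NotInside l) c
label-notInside (((b , σ) , e) ∷ c) u (here refl) =
  inj₁ ≤-refl ∷ ∉-expand⇒notInside c (unique-disjoint (run σ b (suc e)) u (start-∈-run σ b e))
label-notInside (((b , σ) , e) ∷ c) u {l} (there l∈) with ∈-run-or-notInside l σ b e
... | inj₁ l∈run = contradiction refl (unique-disjoint (run σ b (suc e)) u l∈run (labels-⊆-expand c l∈))
... | inj₂ ni    = ni ∷ label-notInside c (unique-++ʳ (run σ b (suc e)) u) l∈

-- A run that `l` does not split contributes either all of its values or none, which is what the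
-- factor `lt` expresses.
below-notInside : ∀ {l} c → All (NotInside l) c → below suc c l ≡ countBelow l (expand c)
below-notInside []                      []        = refl
below-notInside {l} (((b , σ) , e) ∷ c) (ni ∷ nis) =
  trans (cong₂ _+_ (head ni) (below-notInside c nis)) (sym (countBelow-++ l (run σ b (suc e)) (expand c)))
  where
    head : NotInside l ((b , σ) , e) → lt b l * suc e ≡ countBelow l (run σ b (suc e))
    head (inj₁ l≤b) = trans (cong (_* suc e) (≥⇒lt l≤b)) (sym (countBelow-run-below σ b (suc e) l≤b))
    head (inj₂ ≤l)  = trans (cong (_* suc e) (<⇒lt (<-≤-trans (m<m+n b z<s) ≤l)))
                        (trans (+-identityʳ (suc e)) (sym (countBelow-run-above σ b (suc e) ≤l)))

below-label : ∀ {c} → Perm (expand c) → ∀ {l} → l ∈ labels c → below suc c l ≡ l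
below-label {c} p l∈ = trans (below-notInside c (label-notInside c (perm-unique p) l∈))
  (All.lookup (countBelow-perm p) (labels-⊆-expand c l∈))

relabel-below : ∀ w {r l} c → All (λ l′ → lt (r l′) (r l) ≡ lt l′ l) (labels c) →
  below w (relabel r c) (r l) ≡ below w c l
relabel-below w []                  []        = refl
relabel-below w (((_ , _) , e) ∷ c) (eq ∷ eqs) = cong₂ _+_ (cong (_* w e) eq) (relabel-below w c eqs)

below-mono : ∀ w c {l l′} → l ≤ l′ → below w c l ≤ below w c l′
below-mono w []                  l≤ = z≤n
below-mono w (((b , _) , e) ∷ c) l≤ = +-mono-≤ (*-monoˡ-≤ (w e) (lt-mono b l≤)) (below-mono w c l≤)

below-jump : ∀ w {c l σ e l′} → ((l , σ) , e) ∈ c → l < l′ → below w c l + w e ≤ below w c l′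
below-jump w {_ ∷ c} {l} {σ} {e} {l′} (here refl) l< = begin
  lt l l * w e + below w c l + w e   ≡⟨ cong (λ m → m * w e + below w c l + w e) (≥⇒lt (≤-refl {l})) ⟩
  below w c l + w e                  ≡⟨ +-comm (below w c l) (w e) ⟩
  w e + below w c l                  ≤⟨ +-mono-≤ (≤-reflexive (sym (+-identityʳ (w e)))) (below-mono w c (<⇒≤ l<)) ⟩
  1 * w e + below w c l′             ≡⟨ cong (λ m → m * w e + below w c l′) (<⇒lt l<) ⟨
  lt l l′ * w e + below w c l′ ∎
  where open ≤-Reasoning
below-jump w {((b , _) , e′) ∷ c} {l} {σ} {e} {l′} (there g∈) l< = begin
  lt b l * w e′ + below w c l + w e    ≡⟨ +-assoc (lt b l * w e′) _ _ ⟩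
  lt b l * w e′ + (below w c l + w e)  ≤⟨ +-mono-≤ (*-monoˡ-≤ (w e′) (lt-mono b (<⇒≤ l<))) (below-jump w g∈ l<) ⟩
  lt b l′ * w e′ + below w c l′ ∎
  where open ≤-Reasoning

Positive : (ℕ → ℕ) → Set
Positive w = ∀ e → 1 ≤ w e

∈-labels⁻ : ∀ c {l} → l ∈ labels c → ∃[ σ ] ∃[ e ] ((l , σ) , e) ∈ c
∈-labels⁻ (_ ∷ c) (here refl) = _ , _ , here refl
∈-labels⁻ (_ ∷ c) (there l∈)  = let σ , e , g∈ = ∈-labels⁻ c l∈ in σ , e , there g∈

-- The run at `l` has positive weight and counts below any larger label but not below `l`.
-- Relabelling by ranks and relabelling by smallest values therefore both preserve the order of the
-- runs.
below-lt : ∀ {w} → Positive w → ∀ {c l} → l ∈ labels c → ∀ l′ → lt (below w c l) (below w c l′) ≡ lt l l′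
below-lt {w} pos {c} {l} l∈ l′ with σ , e , g∈ ← ∈-labels⁻ c l∈ with <-≤-connex l l′
... | inj₁ l<l′ = trans (<⇒lt (<-≤-trans (m<m+n (below w c l) (pos e)) (below-jump w g∈ l<l′))) (sym (<⇒lt l<l′))
... | inj₂ l′≤l = trans (≥⇒lt (below-mono w c l′≤l)) (sym (≥⇒lt l′≤l))

squeeze : ∀ {p q p′ q′} → p ≤ p′ → q ≤ q′ → p′ + q′ ≤ p + q → p′ ≤ p × q′ ≤ q
squeeze {p} {q} {p′} {q′} p≤ q≤ h =
  +-cancelʳ-≤ q p′ p (≤-trans (+-monoʳ-≤ p′ q≤) h) , +-cancelˡ-≤ p q′ q (≤-trans (+-monoˡ-≤ q′ p≤) h)

lt-eq : ∀ b {l l′} → l ≤ l′ → ∀ {m} → 1 ≤ m → lt b l′ * m ≤ lt b l * m → lt b l′ ≡ lt b l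
lt-eq b l≤ (s≤s {n = m} z≤n) h = ≤-antisym (*-cancelʳ-≤ _ _ (suc m) h) (lt-mono b l≤)

module _ {w : ℕ → ℕ} (pos : Positive w) (v : ℕ → ℕ) where

  -- Every summand is monotone in the label, so equal totals force equal summands. By positivity no
  -- run starts between the two labels, a fact independent of the weights.
  below-constant : ∀ c {l l′} → l ≤ l′ → below w c l′ ≤ below w c l → below v c l′ ≡ below v c l
  below-constant []                  l≤ h = refl
  below-constant (((b , _) , e) ∷ c) l≤ h =
    let h₁ , h₂ = squeeze (*-monoˡ-≤ (w e) (lt-mono b l≤)) (below-mono w c l≤) h
    in cong₂ _+_ (cong (_* v e) (lt-eq b l≤ (pos e) h₁)) (below-constant c l≤ h₂)

  -- If the run at l is the only one between l and l′ for one choice of weights,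
  -- it is for every other.
  below-adjacent : ∀ {c l σ e l′} → ((l , σ) , e) ∈ c → l < l′ → below w c l′ ≤ below w c l + w e →
    below v c l′ ≡ below v c l + v e
  below-adjacent {_ ∷ c} {l} {σ} {e} {l′} (here refl) l< h
    rewrite ≥⇒lt (≤-refl {l}) | <⇒lt l< | +-identityʳ (w e) | +-identityʳ (v e) =
    trans (cong (v e +_) (below-constant c (<⇒≤ l<)
      (+-cancelˡ-≤ (w e) _ _ (subst (w e + below w c l′ ≤_) (+-comm (below w c l) (w e)) h))))
      (+-comm (v e) _)
  below-adjacent {((b , _) , e′) ∷ c} {l} {σ} {e} {l′} (there g∈) l< h =
    let h₁ , h₂ = squeeze (*-monoˡ-≤ (w e′) (lt-mono b (<⇒≤ l<))) (below-jump w g∈ l<)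
                    (subst (lt b l′ * w e′ + below w c l′ ≤_) (+-assoc (lt b l * w e′) _ _) h)
    in trans (cong₂ _+_ (cong (_* v e′) (lt-eq b (<⇒≤ l<) (pos e′) h₁)) (below-adjacent g∈ l< h₂))
         (sym (+-assoc (lt b l * v e′) _ _))

-- Relative codes that arise from permutations

one-positive : Positive one
one-positive _ = ≤-refl

suc-positive : Positive suc
suc-positive _ = s≤s z≤n

-- The relative counterpart of `Merges`: consecutive ranks replace consecutive values, and of the
-- lengths it matters only whether they are one. This later makes maximality insensitive to exact
-- lengths.
Adjacent : Item → Item → Set
Adjacent g h = (label h ≡ suc (label g) × Up g × Up h) ⊎ (label g ≡ suc (label h) × Down g × Down h)

-- If in addition the entries of `inflate c` are distinct, these conditions make `c` the code of the
-- list it inflates to.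
Good : Code → Set
Good c = All (λ l → below one c l ≡ l) (labels c) × Linked (λ g h → ¬ Adjacent g h) c × All Normal c

module _ {c : Code} where

  private
    B = below suc c

    rank-suc : ∀ {l σ e l′} → ((l , σ) , e) ∈ c → below one c l ≡ l → below one c l′ ≡ l′ →
               B l′ ≡ B l + suc e → l′ ≡ suc l
    rank-suc {l} {e = e} {l′} g∈ fix fix′ eq with <-≤-connex l l′
    ... | inj₁ l<l′ = trans (sym fix′) (trans (below-adjacent suc-positive one g∈ l<l′ (≤-reflexive eq))
                        (trans (+-comm _ 1) (cong suc fix)))
    ... | inj₂ l′≤l = contradiction (below-mono suc c l′≤l) (<⇒≱ (subst (B l <_) (sym eq) (m<m+n (B l) z<s)))

  -- When one run ends exactly where the other begins, the bases differ by the length of the lower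
  -- run, so no other run lies between and the ranks are consecutive.
  merges⇒adjacent : ∀ {g h} → g ∈ c → h ∈ c → label g ≢ label h →
    below one c (label g) ≡ label g → below one c (label h) ≡ label h →
    Merges (final (relabelItem B g)) (relabelItem B h) → Adjacent g h
  merges⇒adjacent {(l , true) , e} g∈ h∈ l≢ fg fh (inj₁ (eq , up)) =
    inj₁ (rank-suc g∈ fg fh (trans (sym eq) (sym (+-suc (B l) e))) , inj₁ refl , up)
  merges⇒adjacent {(l , false) , zero} g∈ h∈ l≢ fg fh (inj₁ (eq , up)) =
    inj₁ (rank-suc g∈ fg fh (trans (sym eq) (+-comm 1 (B l))) , inj₂ refl , up)
  -- A decreasing run of several values already contains the successor of its last value, so `h`
  -- would have to begin inside `g`.
  merges⇒adjacent {(l , false) , suc e} {(l′ , _) , _} g∈ h∈ l≢ fg fh (inj₁ (eq , up)) with <-≤-connex l l′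
  ... | inj₁ l<l′ = contradiction (below-jump suc g∈ l<l′)
        (<⇒≱ (subst (_< B l + (2 + e)) eq (subst (_≤ B l + (2 + e)) (+-comm (B l) 2) (+-monoʳ-≤ (B l) (m≤m+n 2 e)))))
  ... | inj₂ l′≤l = contradiction (below-mono suc c l′≤l) (<⇒≱ (subst (B l <_) eq (n<1+n (B l))))
  merges⇒adjacent {(l , false) , e} {(l′ , _) , e′} g∈ h∈ l≢ fg fh (inj₂ (eq , dn)) =
    inj₂ (rank-suc h∈ fh fg (trans eq (sym (+-suc (B l′) e′))) , inj₁ refl , dn)
  merges⇒adjacent {(l , true) , zero} {(l′ , _) , e′} g∈ h∈ l≢ fg fh (inj₂ (eq , dn)) =
    inj₂ (rank-suc h∈ fh fg (trans (sym (+-identityʳ (B l))) (trans eq (sym (+-suc (B l′) e′)))) , inj₂ refl , dn)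
  merges⇒adjacent {(l , true) , suc e} {(l′ , _) , e′} g∈ h∈ l≢ fg fh (inj₂ (eq , dn)) with <-≤-connex l l′
  ... | inj₁ l<l′ = contradiction eq (<⇒≢ (<-≤-trans
        (subst (_≤ B l′) (+-suc (B l) (suc e)) (below-jump suc g∈ l<l′)) (≤-trans (m≤m+n (B l′) e′) (n≤1+n _))))
  ... | inj₂ l′≤l = contradiction (sym eq) (<⇒≢ (≤-<-trans
        (subst (_≤ B l) (+-suc (B l′) e′) (below-jump suc h∈ (≤∧≢⇒< l′≤l (l≢ ∘ sym)))) (m<m+n (B l) z<s)))

  adjacent⇒merges : ∀ {g h} → g ∈ c → h ∈ c → B (label g) ≡ label g → B (label h) ≡ label h →
    Adjacent (relabelItem (below one c) g) (relabelItem (below one c) h) → Merges (final g) h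
  adjacent⇒merges {(b , σ) , e} {(b′ , σ′) , e′} g∈ h∈ fg fh (inj₁ (eq , up , up′)) = inj₁ (finalUp σ e start up , up′)
    where
      b<b′ : b < b′
      b<b′ = ≰⇒> λ b′≤b → <⇒≱ (subst (below one c b <_) (sym eq) (n<1+n _)) (below-mono one c b′≤b)
      start : b′ ≡ b + suc e
      start = trans (sym fh) (trans (below-adjacent one-positive suc g∈ b<b′
        (≤-reflexive (trans eq (+-comm 1 _)))) (cong (_+ suc e) fg))
      finalUp : ∀ σ e → b′ ≡ b + suc e → σ ≡ true ⊎ e ≡ 0 → suc (final ((b , σ) , e)) ≡ b′
      finalUp true  e    start _         = trans (sym (+-suc b e)) (sym start)
      finalUp false zero start _         = trans (+-comm 1 b) (sym start)
      finalUp false (suc e) start (inj₁ ())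
      finalUp false (suc e) start (inj₂ ())
  adjacent⇒merges {(b , σ) , e} {(b′ , σ′) , e′} g∈ h∈ fg fh (inj₂ (eq , dn , dn′)) = inj₂ (trans (finalDown σ e dn) start , dn′)
    where
      b′<b : b′ < b
      b′<b = ≰⇒> λ b≤b′ → <⇒≱ (subst (below one c b′ <_) (sym eq) (n<1+n _)) (below-mono one c b≤b′)
      start : b ≡ suc (b′ + e′)
      start = trans (sym fg) (trans (below-adjacent one-positive suc h∈ b′<b
        (≤-reflexive (trans eq (+-comm 1 _)))) (trans (cong (_+ suc e′) fh) (+-suc b′ e′)))
      finalDown : ∀ σ e → σ ≡ false ⊎ e ≡ 0 → final ((b , σ) , e) ≡ b
      finalDown false e _          = refl
      finalDown true zero _        = +-identityʳ b
      finalDown true (suc e) (inj₁ ())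
      finalDown true (suc e) (inj₂ ())

linked-map : ∀ {R S : Item → Item → Set} {f : Item → Item} {c} →
  (∀ {g h} → g ∈ c → h ∈ c → label g ≢ label h → R g h → S (f g) (f h)) →
  Unique (labels c) → Linked R c → Linked S (map f c)
linked-map tr u                []      = []
linked-map tr u                [-]     = [-]
linked-map tr ((l≢ ∷ _) ∷ u)   (r ∷ l) = tr (here refl) (there (here refl)) l≢ r ∷
  linked-map (λ g∈ h∈ → tr (there g∈) (there h∈)) u l

labels-relabel : ∀ r c → labels (relabel r c) ≡ map r (labels c)
labels-relabel r c = trans (sym (map-∘ c)) (map-∘ c)

label-∈ : ∀ {g c} → g ∈ c → label g ∈ labels c
label-∈ = ∈-map⁺ label

relabel-relabel : ∀ {r s c} → All (λ l → s (r l) ≡ l) (labels c) → relabel s (relabel r c) ≡ c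
relabel-relabel {c = c} h = trans (sym (map-∘ c)) (map-id-local (All.map (cong λ l → (l , _) , _) (All.map⁻ h)))

decompose-inflate : ∀ {c} → Good c → Unique (inflate c) → decompose (inflate c) ≡ c
decompose-inflate {c} (ranked , linked , normal) u = trans
  (cong (λ A → relabel (below one A) A) (parse-expand separated (All.map⁺ normal)))
  (relabel-relabel {c = c} (All.map (λ {l} fix → trans (relabel-below one c (All.tabulate λ l′∈ → below-lt suc-positive l′∈ l)) fix) ranked))
  where
    A = relabel (below suc c) c
    labels-u : Unique (labels c)
    labels-u = Unique.map⁻ (subst Unique (labels-relabel (below suc c) c) (labels-unique A u))
    separated : Linked Separated A
    separated = linked-map (λ g∈ h∈ l≢ ¬adj → ¬adj ∘ merges⇒adjacent g∈ h∈ l≢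
      (All.lookup ranked (label-∈ g∈)) (All.lookup ranked (label-∈ h∈))) labels-u linked

module _ {π} (perm : Perm π) where

  private
    A = parse π
    r = below one A

    fixed : ∀ {l} → l ∈ labels A → below suc A l ≡ l
    fixed = below-label {A} (subst Perm (sym (expand-parse π)) perm)

    rank-lt : ∀ {l′} → l′ ∈ labels A → ∀ l → lt (r l′) (r l) ≡ lt l′ l
    rank-lt l′∈ l = below-lt one-positive l′∈ l

    relabelled : ∀ w l → below w (relabel r A) (r l) ≡ below w A l
    relabelled w l = relabel-below w A (All.tabulate λ l′∈ → rank-lt l′∈ l)

  inflate-decompose : inflate (decompose π) ≡ π
  inflate-decompose = trans
    (cong expand (relabel-relabel {c = A} (All.tabulate λ {l} l∈ → trans (relabelled suc l) (fixed l∈))))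
    (expand-parse π)

  decompose-good : Good (decompose π)
  decompose-good =
    subst (All _) (sym (labels-relabel r A)) (All.map⁺ (All.universal (relabelled one) (labels A))) ,
    linked-map (λ g∈ h∈ _ sep → sep ∘ adjacent⇒merges g∈ h∈ (fixed (label-∈ g∈)) (fixed (label-∈ h∈)))
      (labels-unique A (subst Unique (sym (expand-parse π)) (perm-unique perm))) (parse-separated π) ,
    All.map⁺ (parse-normal π)

-- Bounds on the ranks and on the number of runs

below-one≤length : ∀ c l → below one c l ≤ length c
below-one≤length []                  l = z≤n
below-one≤length (((b , _) , _) ∷ c) l = +-mono-≤
  (subst (_≤ 1) (sym (*-identityʳ (lt b l))) (lt≤1 b l)) (below-one≤length c l)
  where
    lt≤1 : ∀ x y → lt x y ≤ 1
    lt≤1 x       zero    = z≤n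
    lt≤1 zero    (suc y) = ≤-refl
    lt≤1 (suc x) (suc y) = lt≤1 x y

length-expand-relabel : ∀ r c → length (expand (relabel r c)) ≡ total c
length-expand-relabel r []                  = refl
length-expand-relabel r (((l , σ) , e) ∷ c) = trans (length-++ (run σ (r l) (suc e)))
  (cong₂ _+_ (length-run σ (r l) (suc e)) (length-expand-relabel r c))

length-inflate : ∀ c → length (inflate c) ≡ total c
length-inflate c = length-expand-relabel (below suc c) c

glue-length : ∀ x c → length (glue x c) ≤ suc (length c)
glue-length x [] = ≤-refl
glue-length x (((b , true) , zero) ∷ c) with suc x ≟ b | x ≟ suc b
... | yes _ | _     = n≤1+n _
... | no  _ | yes _ = n≤1+n _
... | no  _ | no  _ = ≤-refl
glue-length x (((b , true) , suc e) ∷ c) with suc x ≟ b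
... | yes _ = n≤1+n _
... | no  _ = ≤-refl
glue-length x (((b , false) , e) ∷ c) with x ≟ suc (b + e)
... | yes _ = n≤1+n _
... | no  _ = ≤-refl

-- Only a turn against the direction of a longer run could prevent gluing, and then `x` would repeat
-- the second value of that run.
glue-length-consecutive : ∀ {x y ys} c → All Normal c → expand c ≡ y ∷ ys → All (x ≢_) ys →
  y ≡ suc x ⊎ x ≡ suc y → length (glue x c) ≡ length c
glue-length-consecutive {x} (((b , true) , zero) ∷ c) n refl x∉ consec with suc x ≟ b | x ≟ suc b
... | yes _ | _     = refl
... | no  _ | yes _ = refl
glue-length-consecutive (((b , true) , zero) ∷ c) n refl x∉ (inj₁ eq) | no ≢ | no _ = contradiction (sym eq) ≢
glue-length-consecutive (((b , true) , zero) ∷ c) n refl x∉ (inj₂ eq) | no _ | no ≢ = contradiction eq ≢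
glue-length-consecutive {x} (((b , true) , suc e) ∷ c) n refl (x≢ ∷ _) consec with suc x ≟ b
... | yes _ = refl
glue-length-consecutive (((b , true) , suc e) ∷ c) n refl (x≢ ∷ _) (inj₁ eq) | no ≢ = contradiction (sym eq) ≢
glue-length-consecutive (((b , true) , suc e) ∷ c) n refl (x≢ ∷ _) (inj₂ eq) | no ≢ = contradiction eq x≢
glue-length-consecutive (((b , false) , zero) ∷ c) (n ∷ _) _ _ _ with () ← n refl
glue-length-consecutive {x} (((b , false) , suc e) ∷ c) n refl (x≢ ∷ _) consec with x ≟ suc (b + suc e)
... | yes _ = refl
glue-length-consecutive (((b , false) , suc e) ∷ c) n refl (x≢ ∷ _) (inj₁ eq) | no ≢ =
  contradiction (suc-injective (trans (sym eq) (+-suc b e))) x≢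
glue-length-consecutive (((b , false) , suc e) ∷ c) n refl (x≢ ∷ _) (inj₂ eq) | no ≢ = contradiction eq ≢

Consecutive : SignedValue → SignedValue → Set
Consecutive (s , x) (t , y) = (s ≡ true × t ≡ true × y ≡ suc x) ⊎ (s ≡ false × t ≡ false × x ≡ suc y)

bad-or-consecutive : ∀ x y → bad x y ≡ 1 ⊎ Consecutive x y
bad-or-consecutive (true  , x) (true  , y) with y ≟ suc x
... | yes refl = inj₂ (inj₁ (refl , refl , refl))
... | no ≢     = inj₁ (cong (λ t → if t then 0 else 1) (dec-false (y ≟ suc x) ≢))
bad-or-consecutive (false , x) (false , y) with x ≟ suc y
... | yes refl = inj₂ (inj₂ (refl , refl , refl))
... | no ≢     = inj₁ (cong (λ t → if t then 0 else 1) (dec-false (x ≟ suc y) ≢))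
bad-or-consecutive (true  , x) (false , y) = inj₁ refl
bad-or-consecutive (false , x) (true  , y) = inj₁ refl

-- A new run can begin only at a bad pair. Consecutive values with unsuitable signs are bad and yet
-- share a run, so this is merely an inequality.
parse-length : ∀ π̂ → Unique (values π̂) → length (parse (values π̂)) ≤ suc (breaks π̂)
parse-length []       u = z≤n
parse-length (x ∷ []) u = ≤-refl
parse-length ((s , x) ∷ (t , y) ∷ π̂) ((_ ∷ x∉) ∷ u) with bad-or-consecutive (s , x) (t , y)
... | inj₁ isBad = begin
  length (glue x (parse (y ∷ values π̂)))          ≤⟨ glue-length x (parse (y ∷ values π̂)) ⟩
  suc (length (parse (y ∷ values π̂)))             ≤⟨ s≤s (parse-length ((t , y) ∷ π̂) u) ⟩
  suc (1 + breaks ((t , y) ∷ π̂))                  ≡⟨ cong (λ m → suc (m + breaks ((t , y) ∷ π̂))) isBad ⟨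
  suc (breaks ((s , x) ∷ (t , y) ∷ π̂)) ∎
  where open ≤-Reasoning
... | inj₂ consec = begin
  length (glue x (parse (y ∷ values π̂)))          ≡⟨ glue-length-consecutive _ (parse-normal (y ∷ values π̂)) (expand-parse (y ∷ values π̂)) x∉ (neighbours consec) ⟩
  length (parse (y ∷ values π̂))                   ≤⟨ parse-length ((t , y) ∷ π̂) u ⟩
  suc (breaks ((t , y) ∷ π̂))                      ≤⟨ s≤s (m≤n+m _ (bad (s , x) (t , y))) ⟩
  suc (breaks ((s , x) ∷ (t , y) ∷ π̂)) ∎
  where
    open ≤-Reasoning
    neighbours : Consecutive (s , x) (t , y) → y ≡ suc x ⊎ x ≡ suc y
    neighbours (inj₁ (_ , _ , eq)) = inj₁ eq
    neighbours (inj₂ (_ , _ , eq)) = inj₂ eq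

-- Whether a code is Good depends only on its shape, which makes this condition stable.
shorten : ℕ → ℕ
shorten zero    = 0
shorten (suc _) = 1

shape : Code → Code
shape = map (map₂ shorten)

below-shape : ∀ c l → below one (shape c) l ≡ below one c l
below-shape []                  l = refl
below-shape (((_ , _) , _) ∷ c) l = cong (_ +_) (below-shape c l)

labels-shape : ∀ c → labels (shape c) ≡ labels c
labels-shape c = sym (map-∘ c)

shorten-zero : ∀ e → shorten e ≡ 0 → e ≡ 0
shorten-zero zero _ = refl

module _ (c : Code) where

  private
    short : ∀ {P : Set} e → P ⊎ e ≡ 0 → P ⊎ shorten e ≡ 0
    short e (inj₁ p)    = inj₁ p
    short e (inj₂ refl) = inj₂ refl
    long : ∀ {P : Set} e → P ⊎ shorten e ≡ 0 → P ⊎ e ≡ 0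
    long e (inj₁ p)  = inj₁ p
    long e (inj₂ eq) = inj₂ (shorten-zero e eq)

    adjacent-shape : ∀ {g h} → Adjacent g h → Adjacent (map₂ shorten g) (map₂ shorten h)
    adjacent-shape {_ , e} {_ , e′} (inj₁ (eq , u , v)) = inj₁ (eq , short e u , short e′ v)
    adjacent-shape {_ , e} {_ , e′} (inj₂ (eq , u , v)) = inj₂ (eq , short e u , short e′ v)
    adjacent-shape⁻ : ∀ {g h} → Adjacent (map₂ shorten g) (map₂ shorten h) → Adjacent g h
    adjacent-shape⁻ {_ , e} {_ , e′} (inj₁ (eq , u , v)) = inj₁ (eq , long e u , long e′ v)
    adjacent-shape⁻ {_ , e} {_ , e′} (inj₂ (eq , u , v)) = inj₂ (eq , long e u , long e′ v)

  good-shape⁺ : Good c → Good (shape c)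
  good-shape⁺ (ranked , linked , normal) =
    subst (All _) (sym (labels-shape c)) (All.map (λ {l} fix → trans (below-shape c l) fix) ranked) ,
    Linked.map⁺ (Linked.map (_∘ adjacent-shape⁻) linked) ,
    All.map⁺ (All.map (λ {g} n → n ∘ shorten-zero (proj₂ g)) normal)

  good-shape⁻ : Good (shape c) → Good c
  good-shape⁻ (ranked , linked , normal) =
    All.map (λ {l} fix → trans (sym (below-shape c l)) fix) (subst (All _) (labels-shape c) ranked) ,
    Linked.map (_∘ adjacent-shape) (Linked.map⁻ linked) ,
    All.map (λ {g} n eq → n (cong shorten eq)) (All.map⁻ normal)

up? : ∀ g → Dec (Up g)
up? ((_ , σ) , e) = (σ Bool.≟ true) ⊎-dec (e ≟ 0)

down? : ∀ g → Dec (Down g)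
down? ((_ , σ) , e) = (σ Bool.≟ false) ⊎-dec (e ≟ 0)

adjacent? : ∀ g h → Dec (Adjacent g h)
adjacent? g h = ((label h ≟ suc (label g)) ×-dec up? g ×-dec up? h) ⊎-dec ((label g ≟ suc (label h)) ×-dec down? g ×-dec down? h)

good? : ∀ c → Dec (Good c)
good? c = All.all? (λ l → below one c l ≟ l) (labels c) ×-dec Linked.linked? (λ g h → ¬? (adjacent? g h)) c
  ×-dec All.all? (λ ((_ , σ) , e) → (e ≟ 0) →-dec (σ Bool.≟ true)) c

-- Stability under lengthening a long run

Split : {A : Set} → (List A → List A → Set) → List A → Set
Split P xs = ∃₂ λ as bs → as ++ bs ≡ xs × P as bs

split? : {A : Set} {P : List A → List A → Set} → (∀ as bs → Dec (P as bs)) → ∀ xs → Dec (Split P xs)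
split? P? [] = map′ (λ p → [] , [] , refl , p) (λ { ([] , [] , refl , p) → p }) (P? [] [])
split? P? (x ∷ xs) = map′
  (λ { (inj₁ p) → [] , x ∷ xs , refl , p ; (inj₂ (as , bs , refl , p)) → x ∷ as , bs , refl , p })
  (λ { ([] , _ , refl , p) → inj₁ p ; (_ ∷ as , bs , refl , p) → inj₂ (as , bs , refl , p) })
  (P? [] (x ∷ xs) ⊎-dec split? (λ as bs → P? (x ∷ as) bs) xs)

module _ {Q : List ℕ → Set} (Q? : Decidable Q) where

  -- The count is the length of a filtered list, so sortability has to be decided. A step is given
  -- by the positions of its cuts, and a list can be cut in only finitely many ways.
  successor? : ∀ op π → Dec (∃ λ ρ → Step op π ρ × Q ρ)
  successor? blockReversal π = map′
    (λ { (a , _ , refl , b , c , refl , q) → _ , brev a b c , q })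
    (λ { (_ , brev a b c , q) → a , _ , refl , b , c , refl , q })
    (split? (λ a → split? (λ b c → Q? (a ++ reverse b ++ c))) π)
  successor? blockTransposition π = map′
    (λ { (a , _ , refl , b , _ , refl , c , d , refl , q) → _ , btr a b c d , q })
    (λ { (_ , btr a b c d , q) → a , _ , refl , b , _ , refl , c , d , refl , q })
    (split? (λ a → split? (λ b → split? (λ c d → Q? (a ++ c ++ b ++ d)))) π)
  successor? blockInterchange π = map′
    (λ { (a , _ , refl , b , _ , refl , c , _ , refl , d , e , refl , q) → _ , bint a b c d e , q })
    (λ { (_ , bint a b c d e , q) → a , _ , refl , b , _ , refl , c , _ , refl , d , e , refl , q })
    (split? (λ a → split? (λ b → split? (λ c → split? (λ d e → Q? (a ++ d ++ c ++ b ++ e))))) π)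
  successor? prefixTransposition π = map′
    (λ { (b , _ , refl , c , d , refl , q) → _ , ptr b c d , q })
    (λ { (_ , ptr b c d , q) → b , _ , refl , c , d , refl , q })
    (split? (λ b → split? (λ c d → Q? (c ++ b ++ d))) π)
  successor? prefixReversal π = map′
    (λ { (b , c , refl , q) → _ , prev b c , q })
    (λ { (_ , prev b c , q) → b , c , refl , q })
    (split? (λ b c → Q? (reverse b ++ c)) π)
  -- Three alternatives cover the four constructors: moving a block left past its neighbour is the
  -- same exchange as moving that neighbour right.
  successor? cutPaste π = map′
    (λ { (a , _ , refl , b , _ , refl , c , d , refl , inj₁ q) → _ , cpR a b c d , q
       ; (a , _ , refl , b , _ , refl , c , d , refl , inj₂ (inj₁ q)) → _ , cpRr a b c d , q
       ; (a , _ , refl , b , _ , refl , c , d , refl , inj₂ (inj₂ q)) → _ , cpLr a c b d , q })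
    (λ { (_ , cpR a b c d , q)  → a , _ , refl , b , _ , refl , c , d , refl , inj₁ q
       ; (_ , cpRr a b c d , q) → a , _ , refl , b , _ , refl , c , d , refl , inj₂ (inj₁ q)
       ; (_ , cpL a b c d , q)  → a , _ , refl , c , _ , refl , b , d , refl , inj₁ q
       ; (_ , cpLr a b c d , q) → a , _ , refl , c , _ , refl , b , d , refl , inj₂ (inj₂ q) })
    (split? (λ a → split? (λ b → split? (λ c d →
      Q? (a ++ c ++ b ++ d) ⊎-dec (Q? (a ++ c ++ reverse b ++ d) ⊎-dec Q? (a ++ reverse c ++ b ++ d))))) π)

within? : ∀ op k σ π → Dec (Within op k π σ)
within? op zero    σ π = map′ (λ { refl → done }) (λ { done → refl }) (≡-dec _≟_ π σ)
within? op (suc k) σ π = map′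
  (λ { (inj₁ refl) → done ; (inj₂ (_ , s , w)) → step s w })
  (λ { done → inj₁ refl ; (step s w) → inj₂ (_ , s , w) })
  (≡-dec _≟_ π σ ⊎-dec successor? (within? op k σ) op π)

-- The last component says that a value which gets multiplied carries the sign of its
-- run, so that its copies prolong the run.
BlowItem : (ℕ → ℕ) → List SignedValue → Item → Item → Set
BlowItem w π̂ ((b , σ) , e) ((b′ , σ′) , e′) =
  σ ≡ σ′ × sumTo w b ≡ b′ × sumFrom w b (suc e) ≡ suc e′ ×
  (∀ {s x} → (s , x) ∈ π̂ → b ≤ x → x < b + suc e → s ≡ σ ⊎ w x ≤ 1)

blowUp-expand : ∀ w {c c′} π̂ → Pointwise (BlowItem w π̂) c c′ → values π̂ ≡ expand c → blowUp w π̂ ≡ expand c′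
blowUp-expand w π̂ items eq = go items π̂ (λ x∈ → x∈) eq
  where
    go : ∀ {c c′} → Pointwise (BlowItem w π̂) c c′ → ∀ ρ̂ → (∀ {x} → x ∈ ρ̂ → x ∈ π̂) →
         values ρ̂ ≡ expand c → blowUp w ρ̂ ≡ expand c′
    go [] [] ⊆ eq = refl
    go {((b , σ) , e) ∷ c} ((refl , start , len , aligned) ∷ items) ρ̂ ⊆ eq
      with r̂ , ŝ , refl , eqr , eqs ← map-++⁻ proj₂ ρ̂ (run σ b (suc e)) eq = trans
        (blowUp-++ w r̂ ŝ)
        (cong₂ _++_
          (trans (blowUp-run w σ b (suc e) r̂ eqr (All.tabulate λ x∈ →
             let b≤ , <b = All.lookup (run-bounds σ b (suc e)) (subst (_ ∈_) eqr (∈-map⁺ proj₂ x∈))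
             in aligned (⊆ (∈-++⁺ˡ x∈)) b≤ <b))
            (cong₂ (run σ) start len))
          (go items ŝ (⊆ ∘ ∈-++⁺ʳ r̂) eqs))

δ≤1 : ∀ a x → δ a x ≤ 1
δ≤1 zero    zero    = ≤-refl
δ≤1 zero    (suc x) = z≤n
δ≤1 (suc a) zero    = z≤n
δ≤1 (suc a) (suc x) = δ≤1 a x

sumFrom-cong-+ : ∀ u v {f} → (∀ x → u x + v x ≡ f x) → ∀ b n → sumFrom u b n + sumFrom v b n ≡ sumFrom f b n
sumFrom-cong-+ u v h b zero    = refl
sumFrom-cong-+ u v {f} h b (suc n) = begin
  (sumFrom u b n + u (b + n)) + (sumFrom v b n + v (b + n)) ≡⟨ solve 4 (λ a b c d → (a :+ b) :+ (c :+ d) := (a :+ c) :+ (b :+ d)) refl (sumFrom u b n) (u (b + n)) (sumFrom v b n) (v (b + n)) ⟩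
  (sumFrom u b n + sumFrom v b n) + (u (b + n) + v (b + n)) ≡⟨ cong₂ _+_ (sumFrom-cong-+ u v h b n) (h (b + n)) ⟩
  sumFrom f b n + f (b + n) ∎
  where open ≡-Reasoning; open +-*-Solver

sumFrom-one : ∀ b n → sumFrom one b n ≡ n
sumFrom-one b zero    = refl
sumFrom-one b (suc n) = trans (+-comm _ 1) (cong suc (sumFrom-one b n))

sumFrom-δ : ∀ a b n → lt a b + sumFrom (δ a) b n ≡ lt a (b + n)
sumFrom-δ a b n = trans (cong (_+ sumFrom (δ a) b n) (sym (sumTo-δ a b))) (trans (sym (sumTo-+ (δ a) b n)) (sumTo-δ a (b + n)))

module Slot (pre : Code) (l : ℕ) (σ : Bool) (e : ℕ) (post : Code) (a : ℕ)
  (u : Unique (labels (pre ++ ((l , σ) , e) ∷ post))) where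

  c : Code
  c = pre ++ ((l , σ) , e) ∷ post

  base : ℕ → ℕ
  base = below suc c

  -- What holds for every run except the one containing `a`: it lies entirely on one side of `a`, on
  -- the same side as its label relative to `l`. Changing the weight of `a` shifts or fixes it but
  -- keeps its length.
  Outside : Item → Set
  Outside ((l′ , _) , e′) = lt a (base l′) ≡ lt l l′ × sumFrom (δ a) (base l′) (suc e′) ≡ 0
    × (∀ {x} → base l′ ≤ x → x < base l′ + suc e′ → δ a x ≡ 0)

  module _ (a≥ : base l ≤ a) (a< : a < base l + suc e) where

    inside : lt a (base l) ≡ 0 × sumFrom (δ a) (base l) (suc e) ≡ 1
    inside = ≥⇒lt a≥ , trans (cong (_+ sumFrom (δ a) (base l) (suc e)) (sym (≥⇒lt a≥)))
      (trans (sumFrom-δ a (base l) (suc e)) (<⇒lt a<))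

    outside : ∀ {i} → i ∈ c → label i ≢ l → Outside i
    outside {(l′ , _) , e′} i∈ l′≢ with <-≤-connex l l′
    ... | inj₁ l<l′ = trans (<⇒lt a<b) (sym (<⇒lt l<l′)) ,
            +-cancelˡ-≡ 1 _ 0 (trans (cong (_+ sumFrom (δ a) (base l′) (suc e′)) (sym (<⇒lt a<b)))
              (trans (sumFrom-δ a (base l′) (suc e′)) (<⇒lt (<-≤-trans a<b (m≤m+n (base l′) (suc e′)))))) ,
            λ b≤x _ → δ-≢ (<⇒≢ (<-≤-trans a<b b≤x))
      where
        a<b : a < base l′
        a<b = <-≤-trans a< (below-jump suc (∈-++⁺ʳ pre (here refl)) l<l′)
    ... | inj₂ l′≤l = trans (≥⇒lt (≤-trans (m≤m+n (base l′) (suc e′)) ≤a)) (sym (≥⇒lt l′≤l)) ,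
            trans (cong (_+ sumFrom (δ a) (base l′) (suc e′)) (sym (≥⇒lt (≤-trans (m≤m+n (base l′) (suc e′)) ≤a))))
              (trans (sumFrom-δ a (base l′) (suc e′)) (≥⇒lt ≤a)) ,
            λ _ x< → δ-≢ (≢-sym (<⇒≢ (<-≤-trans x< ≤a)))
      where
        ≤a : base l′ + suc e′ ≤ a
        ≤a = ≤-trans (below-jump suc i∈ (≤∧≢⇒< l′≤l l′≢)) a≥

    private
      labels≢ : All (λ i → label i ≢ l) pre × All (λ i → label i ≢ l) post
      labels≢ = go pre u
        where
          go : ∀ pre → Unique (labels (pre ++ ((l , σ) , e) ∷ post)) →
               All (λ i → label i ≢ l) pre × All (λ i → label i ≢ l) post
          go []        (l∉ ∷ _) = [] , All.map ≢-sym (All.map⁻ l∉)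
          go (i ∷ pre) (i∉ ∷ u) = let p , q = go pre u in
            All.lookup i∉ (label-∈ {((l , σ) , e)} (∈-++⁺ʳ pre (here refl))) ∷ p , q

    outside-pre : All Outside pre
    outside-pre = All.tabulate λ i∈ → outside (∈-++⁺ˡ i∈) (All.lookup (proj₁ labels≢) i∈)

    outside-post : All Outside post
    outside-post = All.tabulate λ i∈ → outside (∈-++⁺ʳ pre (there i∈)) (All.lookup (proj₂ labels≢) i∈)

below-grow : ∀ pre {l σ e post} x →
  below suc (pre ++ ((l , σ) , suc e) ∷ post) x ≡ below suc (pre ++ ((l , σ) , e) ∷ post) x + lt l x
below-grow [] {l} {σ} {e} {post} x =
  solve 3 (λ t e y → t :* (con 2 :+ e) :+ y := (t :* (con 1 :+ e) :+ y) :+ t) refl (lt l x) e (below suc post x)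
  where open +-*-Solver
below-grow (((l′ , _) , e′) ∷ pre) {l} x = trans (cong (lt l′ x * suc e′ +_) (below-grow pre x)) (sym (+-assoc (lt l′ x * suc e′) _ _))

pointwise-at : ∀ {R : Item → Item → Set} {pre g g′ post} → All (λ i → R i i) pre → R g g′ → All (λ i → R i i) post →
  Pointwise R (pre ++ g ∷ post) (pre ++ g′ ∷ post)
pointwise-at {R} pre r post = Pointwise.++⁺ (diag pre) (r ∷ diag post)
  where
    diag : ∀ {c} → All (λ i → R i i) c → Pointwise R c c
    diag []       = []
    diag (r ∷ rs) = r ∷ diag rs

module _ (pre : Code) (l : ℕ) (σ : Bool) (e : ℕ) (post : Code) where

  private
    c c⁺ : Code
    c  = pre ++ ((l , σ) , e) ∷ post
    c⁺ = pre ++ ((l , σ) , suc e) ∷ post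

  -- Only `a` receives weight two, so its sign is the only one that has to match the direction of
  -- the run.
  blowUp-grow : ∀ {a} → Unique (labels c) → below suc c l ≤ a → a < below suc c l + suc e →
    ∀ π̂ → values π̂ ≡ inflate c → (∀ {s} → (s , a) ∈ π̂ → s ≡ σ) → blowUp (suc ∘ δ a) π̂ ≡ inflate c⁺
  blowUp-grow {a} u a≥ a< π̂ over sign = blowUp-expand w π̂
    (Pointwise.map⁺ (relabelItem base) (relabelItem base⁺) (pointwise-at
      (All.map other (outside-pre a≥ a<)) slot (All.map other (outside-post a≥ a<)))) over
    where
      open Slot pre l σ e post a u hiding (c)
      w = suc ∘ δ a
      base⁺ = below suc c⁺

      sum-w : ∀ b n → sumFrom w b n ≡ n + sumFrom (δ a) b n
      sum-w b n = trans (sym (sumFrom-cong-+ one (δ a) (λ _ → refl) b n)) (cong (_+ sumFrom (δ a) b n) (sumFrom-one b n))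

      start : ∀ l′ → lt a (base l′) ≡ lt l l′ → sumTo w (base l′) ≡ base⁺ l′
      start l′ eq = trans (sum-w 0 (base l′)) (trans (cong (base l′ +_) (trans (sumTo-δ a (base l′)) eq)) (sym (below-grow pre l′)))

      other : ∀ {i} → Outside i → BlowItem w π̂ (relabelItem base i) (relabelItem base⁺ i)
      other {(l′ , σ′) , e′} (pos , len , away) = refl , start l′ pos ,
        trans (sum-w (base l′) (suc e′)) (trans (cong (suc e′ +_) len) (+-identityʳ (suc e′))) ,
        λ _ b≤x x< → inj₂ (s≤s (≤-reflexive (away b≤x x<)))

      slot : BlowItem w π̂ (relabelItem base ((l , σ) , e)) (relabelItem base⁺ ((l , σ) , suc e))
      slot = let pos , len = inside a≥ a< in
        refl , start l (trans pos (sym (≥⇒lt (≤-refl {l})))) ,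
        trans (sum-w (base l) (suc e)) (trans (cong (suc e +_) len) (+-comm (suc e) 1)) , aligned
        where
          aligned : ∀ {s x} → (s , x) ∈ π̂ → base l ≤ x → x < base l + suc e → s ≡ σ ⊎ w x ≤ 1
          aligned {s} {x} s∈ _ _ with a ≟ x
          ... | yes refl = inj₁ (sign s∈)
          ... | no a≢x   = inj₂ (s≤s (≤-reflexive (δ-≢ a≢x)))

  -- All weights are at most one here, so the statement needs no condition on signs.
  blowUp-shrink : ∀ {a} → Unique (labels c⁺) → below suc c⁺ l ≤ a → a < below suc c⁺ l + suc (suc e) →
    ∀ π̂ → values π̂ ≡ inflate c⁺ → blowUp (λ x → 1 ∸ δ a x) π̂ ≡ inflate c
  blowUp-shrink {a} u a≥ a< π̂ over = blowUp-expand w π̂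
    (Pointwise.map⁺ (relabelItem base) (relabelItem base⁻) (pointwise-at
      (All.map other (outside-pre a≥ a<)) slot (All.map other (outside-post a≥ a<)))) over
    where
      open Slot pre l σ (suc e) post a u hiding (c)
      w : ℕ → ℕ
      w x = 1 ∸ δ a x
      base⁻ = below suc c

      sum-w : ∀ b n → sumFrom w b n + sumFrom (δ a) b n ≡ n
      sum-w b n = trans (sumFrom-cong-+ w (δ a) (λ x → m∸n+n≡m (δ≤1 a x)) b n) (sumFrom-one b n)

      start : ∀ l′ → lt a (base l′) ≡ lt l l′ → sumTo w (base l′) ≡ base⁻ l′
      start l′ eq = +-cancelʳ-≡ (lt l l′) _ _ (trans (cong (sumTo w (base l′) +_) (sym (trans (sumTo-δ a (base l′)) eq)))
        (trans (sum-w 0 (base l′)) (below-grow pre l′)))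

      short : ∀ x → w x ≤ 1
      short x = m∸n≤m 1 (δ a x)

      other : ∀ {i} → Outside i → BlowItem w π̂ (relabelItem base i) (relabelItem base⁻ i)
      other {(l′ , σ′) , e′} (pos , len , away) = refl , start l′ pos ,
        trans (sym (+-identityʳ _)) (trans (cong (sumFrom w (base l′) (suc e′) +_) (sym len)) (sum-w (base l′) (suc e′))) ,
        λ {_} {x} _ _ _ → inj₂ (short x)

      slot : BlowItem w π̂ (relabelItem base ((l , σ) , suc e)) (relabelItem base⁻ ((l , σ) , e))
      slot = let pos , len = inside a≥ a< in
        refl , start l (trans pos (sym (≥⇒lt (≤-refl {l})))) ,
        +-cancelʳ-≡ 1 _ _ (trans (cong (sumFrom w (base l) (2 + e) +_) (sym len)) (trans (sum-w (base l) (2 + e)) (+-comm 1 (suc e)))) ,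
        λ {_} {x} _ _ _ → inj₂ (short x)

-- In a run longer than its number of breaks, two neighbours are consecutive with
-- respect to their signs, so their sign is the direction of the run.
aligned-value : ∀ σ b e r̂ → values r̂ ≡ run σ b (suc e) → breaks r̂ < e → ∃[ a ] (σ , a) ∈ r̂
aligned-value true b (suc e) ((s , x) ∷ (t , y) ∷ r̂) eq br<
  with refl , eq₁ ← ∷-injective eq with refl , _ ← ∷-injective eq₁ with bad-or-consecutive (s , b) (t , suc b)
... | inj₁ isBad = let a , a∈ = aligned-value true (suc b) e ((t , suc b) ∷ r̂) eq₁
                         (≤-pred (subst (λ m → m + breaks ((t , suc b) ∷ r̂) < suc e) isBad br<)) in a , there a∈
... | inj₂ (inj₁ (refl , _)) = b , here refl
... | inj₂ (inj₂ (_ , _ , b≡)) = contradiction b≡ (<⇒≢ (m≤n⇒m≤1+n (n<1+n b)))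
aligned-value false b (suc e) ((s , x) ∷ (t , y) ∷ r̂) eq br<
  with refl , eq₁ ← ∷-injective eq with refl , _ ← ∷-injective eq₁ with bad-or-consecutive (s , b + suc e) (t , b + e)
... | inj₁ isBad = let a , a∈ = aligned-value false b e ((t , b + e) ∷ r̂) eq₁
                         (≤-pred (subst (λ m → m + breaks ((t , b + e) ∷ r̂) < suc e) isBad br<)) in a , there a∈
... | inj₂ (inj₂ (refl , _)) = b + suc e , here refl
... | inj₂ (inj₁ (_ , _ , eq₂)) = contradiction (trans eq₂ (cong suc (+-suc b e))) (<⇒≢ (m≤n⇒m≤1+n (n<1+n (b + e))))

sign-unique : ∀ {π̂ s t a} → Unique (values π̂) → (s , a) ∈ π̂ → (t , a) ∈ π̂ → s ≡ t
sign-unique u        (here refl) (here refl) = refl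
sign-unique (a∉ ∷ u) (here refl) (there t∈)  = contradiction refl (All.lookup a∉ (∈-map⁺ proj₂ t∈))
sign-unique (a∉ ∷ u) (there s∈)  (here refl) = contradiction refl (All.lookup a∉ (∈-map⁺ proj₂ s∈))
sign-unique (_ ∷ u)  (there s∈)  (there t∈)  = sign-unique u s∈ t∈

expand-++ : ∀ c d → expand (c ++ d) ≡ expand c ++ expand d
expand-++ []                  d = refl
expand-++ (((b , σ) , e) ∷ c) d = trans (cong (run σ b (suc e) ++_) (expand-++ c d)) (sym (++-assoc (run σ b (suc e)) _ _))

labels-unique-inflate : ∀ c → Unique (inflate c) → Unique (labels c)
labels-unique-inflate c u =
  Unique.map⁻ (subst Unique (labels-relabel (below suc c) c) (labels-unique (relabel (below suc c) c) u))

slot-values : ∀ pre l σ e post π̂ → let c = pre ++ ((l , σ) , e) ∷ post in values π̂ ≡ inflate c →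
  ∃[ p̂ ] ∃[ r̂ ] ∃[ q̂ ] (π̂ ≡ p̂ ++ r̂ ++ q̂ × values r̂ ≡ run σ (below suc c l) (suc e))
slot-values pre l σ e post π̂ over =
  let B = below suc (pre ++ ((l , σ) , e) ∷ post)
      p̂ , r̂ , q̂ , eq , _ , eqr , _ = map-++₃⁻ proj₂ π̂ (expand (relabel B pre)) (run σ (B l) (suc e))
        (trans over (trans (cong expand (map-++ (relabelItem B) pre _)) (expand-++ (relabel B pre) _)))
  in p̂ , r̂ , q̂ , eq , eqr

-- Counting the sortable permutations

module _ (op : Op) (k : ℕ) where

  SortsToId : List ℕ → Set
  SortsToId π = Within op k π (upTo (length π))

  within⇒sortsToId : ∀ {π ρ m} → π ≡ ρ → Within op k π (upTo m) → SortsToId ρ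
  within⇒sortsToId {π} refl within = subst (λ m → Within op k π (upTo m))
    (trans (sym (length-upTo _)) (sym (Perm.↭-length (within-↭ within)))) within

  -- The run has `e` neighbouring pairs, whereas the whole signed source has at most `k * 4` breaks.
  -- Some pair in the run is intact, and a value of that pair is duplicated.
  sortsToId-grow : ∀ pre l σ e post → k * 4 < e →
    SortsToId (inflate (pre ++ ((l , σ) , e) ∷ post)) → SortsToId (inflate (pre ++ ((l , σ) , suc e) ∷ post))
  sortsToId-grow pre l σ e post big within
    with lift π̂ over breaks≤ blown ← sortLift within
    with p̂ , r̂ , q̂ , refl , eqr ← slot-values pre l σ e post π̂ over
    with a , a∈ ← aligned-value σ _ e r̂ eqr (≤-<-trans (≤-trans (≤-trans (m≤m+n (breaks r̂) (breaks q̂)) (breaks-+-≤ r̂ q̂))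
           (≤-trans (m≤n+m (breaks (r̂ ++ q̂)) (breaks p̂)) (≤-trans (breaks-+-≤ p̂ (r̂ ++ q̂)) breaks≤))) big)
    = within⇒sortsToId grown (blown (suc ∘ δ a))
    where
      c = pre ++ ((l , σ) , e) ∷ post
      u : Unique (inflate c)
      u = perm-unique (within⇒perm within)
      bounds : below suc c l ≤ a × a < below suc c l + suc e
      bounds = All.lookup (run-bounds σ (below suc c l) (suc e)) (subst (a ∈_) eqr (∈-map⁺ proj₂ a∈))
      grown : blowUp (suc ∘ δ a) (p̂ ++ r̂ ++ q̂) ≡ inflate (pre ++ ((l , σ) , suc e) ∷ post)
      grown = blowUp-grow pre l σ e post (labels-unique-inflate c u) (proj₁ bounds) (proj₂ bounds) (p̂ ++ r̂ ++ q̂) over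
        (λ s∈ → sign-unique (subst Unique (sym over) u) s∈ (∈-++⁺ʳ p̂ (∈-++⁺ˡ a∈)))

  -- Any value of the run may be deleted; the smallest is chosen.
  sortsToId-shrink : ∀ pre l σ e post →
    SortsToId (inflate (pre ++ ((l , σ) , suc e) ∷ post)) → SortsToId (inflate (pre ++ ((l , σ) , e) ∷ post))
  sortsToId-shrink pre l σ e post within with lift π̂ over _ blown ← sortLift within =
    within⇒sortsToId
      (blowUp-shrink pre l σ e post (labels-unique-inflate c⁺ (perm-unique (within⇒perm within)))
        ≤-refl (m<m+n (below suc c⁺ l) z<s) π̂ over)
      (blown (λ x → 1 ∸ δ (below suc c⁺ l) x))
    where c⁺ = pre ++ ((l , σ) , suc e) ∷ post

  -- Taking `Good` of the shape, which is equivalent to `Good c`, makes its stability an equality of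
  -- shapes.
  Admissible : Code → Set
  Admissible c = Good (shape c) × SortsToId (inflate c)

  admissible? : Decidable Admissible
  admissible? c = good? (shape c) ×-dec within? op k _ (inflate c)

  admissible-stable : Stable (suc (k * 4)) Admissible
  -- The threshold is positive, so the run has at least two values before and after lengthening, and
  -- `shorten` gives 1 both times.
  admissible-stable pre (l , σ) (suc e) post big@(s≤s _) = mk⇔
    (λ (good , sorts) → subst Good same good , sortsToId-grow pre l σ (suc e) post big sorts)
    (λ (good , sorts) → subst Good (sym same) good , sortsToId-shrink pre l σ (suc e) post sorts)
    where
      same : shape (pre ++ ((l , σ) , suc e) ∷ post) ≡ shape (pre ++ ((l , σ) , 2 + e) ∷ post)
      same = trans (map-++ (map₂ shorten) pre _) (sym (map-++ (map₂ shorten) pre _))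

  maxRuns : ℕ
  maxRuns = suc (k * 4)

  -- `below-one≤length` allows a rank to equal the number of runs, hence the bound `suc maxRuns`.
  letters : List (ℕ × Bool)
  letters = cartesianProduct (upTo (suc maxRuns)) (true ∷ false ∷ [])

  letters-unique : Unique letters
  letters-unique = Unique.cartesianProduct⁺ (Unique.upTo⁺ (suc maxRuns)) (((λ ()) ∷ []) ∷ [] ∷ [])

  codes : ℕ → List Code
  codes n = filter admissible? (wordsUpTo letters maxRuns n)

  admissible⇒decompose : ∀ {c} → Admissible c → decompose (inflate c) ≡ c
  admissible⇒decompose {c} (good , sorts) = decompose-inflate (good-shape⁻ c good) (perm-unique (within⇒perm sorts))

  decompose-∈ : ∀ {π} → Sortable op k π → decompose π ∈ codes (length π)
  decompose-∈ {π} (perm , within) = ∈-filter⁺ admissible?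
    (subst (λ n → decompose π ∈ wordsUpTo letters maxRuns n) size
      (∈-wordsUpTo⁺ letters (subst (_≤ maxRuns) (sym (length-map _ (parse π))) few)
        (All.map⁺ (All.universal letter (parse π)))))
    (good-shape⁺ (decompose π) (decompose-good perm) , subst SortsToId (sym (inflate-decompose perm)) within)
    where
      size : total (decompose π) ≡ length π
      size = trans (sym (length-inflate (decompose π))) (cong length (inflate-decompose perm))
      few : length (parse π) ≤ maxRuns
      few with lift π̂ refl breaks≤ _ ← sortLift within = ≤-trans (parse-length π̂ (perm-unique perm)) (s≤s breaks≤)
      letter : ∀ i → proj₁ (relabelItem (below one (parse π)) i) ∈ letters
      letter ((l , σ) , _) = ∈-cartesianProduct⁺
        (∈-upTo⁺ (s≤s (≤-trans (below-one≤length (parse π) l) few))) (bool σ)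
        where
          bool : ∀ σ → σ ∈ true ∷ false ∷ []
          bool true  = here refl
          bool false = there (here refl)

  sortable-count : ∀ n → HasCount (Sortable op k) n (length (codes n))
  sortable-count n = map inflate (codes n) , unique , (λ σ → mk⇔ sound complete) , length-map inflate (codes n)
    where
      unique : Unique (map inflate (codes n))
      -- On admissible codes `decompose` undoes `inflate`, so distinct codes give distinct
      -- permutations.
      unique = Unique.map⁻ {f = decompose} (subst Unique
        (trans (sym (map-id-local (All.map admissible⇒decompose (All.all-filter admissible? (wordsUpTo letters maxRuns n))))) (map-∘ (codes n)))
        (Unique.filter⁺ admissible? (wordsUpTo-unique letters letters-unique maxRuns n)))
      sound : ∀ {σ} → σ ∈ map inflate (codes n) → Sortable op k σ × length σ ≡ n
      sound σ∈ with c , c∈ , refl ← ∈-map⁻ inflate σ∈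
               with c∈words , _ , sorts ← ∈-filter⁻ admissible? {xs = wordsUpTo letters maxRuns n} c∈ =
        (within⇒perm sorts , sorts) , trans (length-inflate c) (proj₂ (∈-wordsUpTo⁻ letters maxRuns n c∈words))
      complete : ∀ {σ} → Sortable op k σ × length σ ≡ n → σ ∈ map inflate (codes n)
      complete (sortable@(perm , _) , refl) = subst (_∈ map inflate (codes n)) (inflate-decompose perm) (∈-map⁺ inflate (decompose-∈ sortable))

theorem4p24 : (op : Op) (k : ℕ) → 1 ≤ k → IsPolynomialClass (Sortable op k)
theorem4p24 op k _ = ((λ π → proj₁) , sortable-closed) , p , N , λ n N≤n → _ , sortable-count op k n , eq n N≤n
  where
    result = eventuallyPoly⇒evalPoly (wordsUpTo-eventuallyPoly (letters op k) (maxRuns op k) (suc (k * 4)) (admissible? op k) (admissible-stable op k))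
    p = proj₁ result
    N = proj₁ (proj₂ result)
    eq = proj₂ (proj₂ result)
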